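{- Let $n\ge 3$ be odd and let $WC_n^d$ denote the fully whiskered $n$-cycle graph. Then $M_2(WC_n^d)\simeq S^{n-1}$.
   Context: The fully whiskered graph of a graph $G$ is obtained by attaching a leaf (a new vertex joined by one edge) to every vertex of $G$; $WC_n^d$ is the fully whiskered graph of the cycle on $n$ vertices. A $2$-matching of a graph is a set of edges such that every vertex has degree at most $2$ in it. $M_2(G)$ is the simplicial complex whose vertices are the edges of $G$ and whose faces are the $2$-matchings of $G$. -}

module Defs where

open import Data.Empty using (⊥-elim)
open import Data.Fin.Base using (Fin; toℕ; _↑ˡ_; _↑ʳ_; splitAt; join)
open import Data.Fin.Properties
  using (_≟_; toℕ-injective; toℕ-fromℕ<; toℕ<n; ↑ˡ-injective; ↑ʳ-injective;
         splitAt-↑ˡ; splitAt-↑ʳ; join-splitAt)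
open import Data.Fin.Subset using (Subset; ⊥; ⁅_⁆; _∈_; _⊆_; _∩_; ∣_∣)
open import Data.Fin.Subset.Properties
  using (p⊆q⇒∣p∣≤∣q∣; ∣⁅x⁆∣≡1; ∣⊥∣≡0; x∈p∩q⁺; x∈p∩q⁻; ∣p∩q∣≤∣p∣)
open import Data.Nat.Base as ℕ using (ℕ; zero; suc; NonZero; z≤n; s≤s)
open import Data.Nat.DivMod using (_%_; _mod_; m%n<n; m<n⇒m%n≡m; n%n≡0)
import Data.Nat.Properties as ℕ
open import Data.Product.Base using (Σ; ∃; _×_; _,_; proj₁; proj₂)
open import Data.Rational.Base as ℚ using (ℚ; 0ℚ; 1ℚ; ½)
import Data.Rational.Properties as ℚ
open import Data.Rational.Solver using (module +-*-Solver)
open import Data.Sum.Base using (_⊎_; inj₁; inj₂; [_,_]′)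
open import Data.Vec.Base using (tabulate)
open import Data.Vec.Functional using (Vector; foldr)
open import Function.Base using (_∘_; id)
open import Relation.Binary.PropositionalEquality
open import Relation.Nullary using (¬_; does)
open import Relation.Nullary.Decidable using (_⊎-dec_)

------------------------------------------------------------------------
-- ℝ consists of Cauchy sequences of rationals with a modulus; the equality
-- of reals is _≈_ below, not _≡_.

IsCauchy : (ℕ → ℚ) → Set
IsCauchy s = ∀ ε → 0ℚ ℚ.< ε →
  ∃ λ N → ∀ m n → N ℕ.≤ m → N ℕ.≤ n → ℚ.∣ s m ℚ.- s n ∣ ℚ.< ε

record ℝ : Set where
  constructor mkℝ
  field
    seq    : ℕ → ℚ
    cauchy : IsCauchy seq

open ℝ public

private

  half : ∀ {ε} → 0ℚ ℚ.< ε → 0ℚ ℚ.< ½ ℚ.* ε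
  half {ε} 0<ε = subst (ℚ._< ½ ℚ.* ε) (ℚ.*-zeroʳ ½) (ℚ.*-monoʳ-<-pos ½ 0<ε)

  half+half : ∀ ε → ½ ℚ.* ε ℚ.+ ½ ℚ.* ε ≡ ε
  half+half ε = trans (sym (ℚ.*-distribʳ-+ ε ½ ½)) (ℚ.*-identityˡ ε)

  p≤∣p∣ : ∀ p → p ℚ.≤ ℚ.∣ p ∣
  p≤∣p∣ p with ℚ.≤-total 0ℚ p
  ... | inj₁ 0≤p = ℚ.≤-reflexive (sym (ℚ.0≤p⇒∣p∣≡p 0≤p))
  ... | inj₂ p≤0 = ℚ.≤-trans p≤0 (ℚ.0≤∣p∣ p)

  ∣p-q∣≡∣q-p∣ : ∀ p q → ℚ.∣ p ℚ.- q ∣ ≡ ℚ.∣ q ℚ.- p ∣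
  ∣p-q∣≡∣q-p∣ p q = trans (sym (ℚ.∣-p∣≡∣p∣ (p ℚ.- q))) (cong ℚ.∣_∣ (lemma p q))
    where
    open +-*-Solver
    lemma : ∀ p q → ℚ.- (p ℚ.- q) ≡ q ℚ.- p
    lemma = solve 2 (λ p q → :- (p :- q) := q :- p) refl

  ∣p∣-∣q∣≤∣p-q∣ : ∀ p q → ℚ.∣ p ∣ ℚ.- ℚ.∣ q ∣ ℚ.≤ ℚ.∣ p ℚ.- q ∣
  ∣p∣-∣q∣≤∣p-q∣ p q = begin
    ℚ.∣ p ∣ ℚ.- ℚ.∣ q ∣
      ≡⟨ cong (λ r → ℚ.∣ r ∣ ℚ.- ℚ.∣ q ∣) (lemma p q) ⟩
    ℚ.∣ (p ℚ.- q) ℚ.+ q ∣ ℚ.- ℚ.∣ q ∣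
      ≤⟨ ℚ.+-monoˡ-≤ (ℚ.- ℚ.∣ q ∣) (ℚ.∣p+q∣≤∣p∣+∣q∣ (p ℚ.- q) q) ⟩
    (ℚ.∣ p ℚ.- q ∣ ℚ.+ ℚ.∣ q ∣) ℚ.- ℚ.∣ q ∣
      ≡⟨ lemma′ ℚ.∣ p ℚ.- q ∣ ℚ.∣ q ∣ ⟩
    ℚ.∣ p ℚ.- q ∣ ∎
    where
    open ℚ.≤-Reasoning
    open +-*-Solver
    lemma : ∀ p q → p ≡ (p ℚ.- q) ℚ.+ q
    lemma = solve 2 (λ p q → p := (p :- q) :+ q) refl
    lemma′ : ∀ p q → (p ℚ.+ q) ℚ.- q ≡ p
    lemma′ = solve 2 (λ p q → (p :+ q) :- q := p) refl

  ∣∣p∣-∣q∣∣≤∣p-q∣ : ∀ p q → ℚ.∣ ℚ.∣ p ∣ ℚ.- ℚ.∣ q ∣ ∣ ℚ.≤ ℚ.∣ p ℚ.- q ∣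
  ∣∣p∣-∣q∣∣≤∣p-q∣ p q with ℚ.∣p∣≡p∨∣p∣≡-p (ℚ.∣ p ∣ ℚ.- ℚ.∣ q ∣)
  ... | inj₁ eq = ℚ.≤-trans (ℚ.≤-reflexive eq) (∣p∣-∣q∣≤∣p-q∣ p q)
  ... | inj₂ eq = begin
    ℚ.∣ ℚ.∣ p ∣ ℚ.- ℚ.∣ q ∣ ∣ ≡⟨ eq ⟩
    ℚ.- (ℚ.∣ p ∣ ℚ.- ℚ.∣ q ∣) ≡⟨ lemma ℚ.∣ p ∣ ℚ.∣ q ∣ ⟩
    ℚ.∣ q ∣ ℚ.- ℚ.∣ p ∣       ≤⟨ ∣p∣-∣q∣≤∣p-q∣ q p ⟩
    ℚ.∣ q ℚ.- p ∣             ≡⟨ ∣p-q∣≡∣q-p∣ q p ⟩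
    ℚ.∣ p ℚ.- q ∣             ∎
    where
    open ℚ.≤-Reasoning
    open +-*-Solver
    lemma : ∀ p q → ℚ.- (p ℚ.- q) ≡ q ℚ.- p
    lemma = solve 2 (λ p q → :- (p :- q) := q :- p) refl

  +-cauchy : ∀ {s t} → IsCauchy s → IsCauchy t → IsCauchy (λ k → s k ℚ.+ t k)
  +-cauchy {s} {t} cs ct ε 0<ε with cs (½ ℚ.* ε) (half 0<ε) | ct (½ ℚ.* ε) (half 0<ε)
  ... | M , hs | N , ht = M ℕ.⊔ N , λ m n m≥ n≥ → begin-strict
    ℚ.∣ (s m ℚ.+ t m) ℚ.- (s n ℚ.+ t n) ∣
      ≡⟨ cong ℚ.∣_∣ (lemma (s m) (t m) (s n) (t n)) ⟩
    ℚ.∣ (s m ℚ.- s n) ℚ.+ (t m ℚ.- t n) ∣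
      ≤⟨ ℚ.∣p+q∣≤∣p∣+∣q∣ (s m ℚ.- s n) (t m ℚ.- t n) ⟩
    ℚ.∣ s m ℚ.- s n ∣ ℚ.+ ℚ.∣ t m ℚ.- t n ∣
      <⟨ ℚ.+-mono-< (hs m n (ℕ.m⊔n≤o⇒m≤o M N m≥) (ℕ.m⊔n≤o⇒m≤o M N n≥))
                    (ht m n (ℕ.m⊔n≤o⇒n≤o M N m≥) (ℕ.m⊔n≤o⇒n≤o M N n≥)) ⟩
    ½ ℚ.* ε ℚ.+ ½ ℚ.* ε
      ≡⟨ half+half ε ⟩
    ε ∎
    where
    open ℚ.≤-Reasoning
    open +-*-Solver
    lemma : ∀ a b c d → (a ℚ.+ b) ℚ.- (c ℚ.+ d) ≡ (a ℚ.- c) ℚ.+ (b ℚ.- d)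
    lemma = solve 4 (λ a b c d → (a :+ b) :- (c :+ d) := (a :- c) :+ (b :- d)) refl

  neg-cauchy : ∀ {s} → IsCauchy s → IsCauchy (λ k → ℚ.- s k)
  neg-cauchy {s} cs ε 0<ε with cs ε 0<ε
  ... | N , hs = N , λ m n m≥ n≥ →
    subst (ℚ._< ε) (trans (∣p-q∣≡∣q-p∣ (s m) (s n)) (cong ℚ.∣_∣ (lemma (s m) (s n)))) (hs m n m≥ n≥)
    where
    open +-*-Solver
    lemma : ∀ a b → b ℚ.- a ≡ (ℚ.- a) ℚ.- (ℚ.- b)
    lemma = solve 2 (λ a b → b :- a := (:- a) :- (:- b)) refl

  ∣∣-cauchy : ∀ {s} → IsCauchy s → IsCauchy (λ k → ℚ.∣ s k ∣)
  ∣∣-cauchy {s} cs ε 0<ε with cs ε 0<ε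
  ... | N , hs = N , λ m n m≥ n≥ →
    ℚ.≤-<-trans (∣∣p∣-∣q∣∣≤∣p-q∣ (s m) (s n)) (hs m n m≥ n≥)

  bounded : ∀ {s} → IsCauchy s →
            ∃ λ B → 0ℚ ℚ.< B × ∃ λ N → ∀ n → N ℕ.≤ n → ℚ.∣ s n ∣ ℚ.≤ B
  bounded {s} cs with cs 1ℚ (ℚ.positive⁻¹ 1ℚ)
  ... | N , hs = 1ℚ ℚ.+ ℚ.∣ s N ∣
               , ℚ.+-mono-<-≤ (ℚ.positive⁻¹ 1ℚ) (ℚ.0≤∣p∣ (s N))
               , N
               , λ n n≥ → begin
    ℚ.∣ s n ∣                              ≡⟨ lemma ℚ.∣ s n ∣ ℚ.∣ s N ∣ ⟩
    (ℚ.∣ s n ∣ ℚ.- ℚ.∣ s N ∣) ℚ.+ ℚ.∣ s N ∣ ≤⟨ ℚ.+-monoˡ-≤ ℚ.∣ s N ∣ (∣p∣-∣q∣≤∣p-q∣ (s n) (s N)) ⟩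
    ℚ.∣ s n ℚ.- s N ∣ ℚ.+ ℚ.∣ s N ∣         ≤⟨ ℚ.+-monoˡ-≤ ℚ.∣ s N ∣ (ℚ.<⇒≤ (hs n N n≥ ℕ.≤-refl)) ⟩
    1ℚ ℚ.+ ℚ.∣ s N ∣                       ∎
    where
    open ℚ.≤-Reasoning
    open +-*-Solver
    lemma : ∀ p q → p ≡ (p ℚ.- q) ℚ.+ q
    lemma = solve 2 (λ p q → p := (p :- q) :+ q) refl

  scaled : ∀ {s} → IsCauchy s → ∀ {B} → 0ℚ ℚ.< B → ∀ {ε} → 0ℚ ℚ.< ε →
           ∃ λ N → ∀ m n → N ℕ.≤ m → N ℕ.≤ n → B ℚ.* ℚ.∣ s m ℚ.- s n ∣ ℚ.< ε
  scaled {s} cs {B} 0<B {ε} 0<ε = go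
    where
    instance
      B-pos : ℚ.Positive B
      B-pos = ℚ.positive 0<B
      B-nz : ℚ.NonZero B
      B-nz = ℚ.pos⇒nonZero B
      1/B-pos : ℚ.Positive (ℚ.1/ B)
      1/B-pos = ℚ.1/pos⇒pos B
    δ : ℚ
    δ = ℚ.1/ B ℚ.* ε
    0<δ : 0ℚ ℚ.< δ
    0<δ = subst (ℚ._< δ) (ℚ.*-zeroʳ (ℚ.1/ B)) (ℚ.*-monoʳ-<-pos (ℚ.1/ B) 0<ε)
    Bδ≡ε : B ℚ.* δ ≡ ε
    Bδ≡ε = trans (sym (ℚ.*-assoc B (ℚ.1/ B) ε))
                 (trans (cong (ℚ._* ε) (ℚ.*-inverseʳ B)) (ℚ.*-identityˡ ε))
    go : ∃ λ N → ∀ m n → N ℕ.≤ m → N ℕ.≤ n → B ℚ.* ℚ.∣ s m ℚ.- s n ∣ ℚ.< ε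
    go with cs δ 0<δ
    ... | N , hs = N , λ m n m≥ n≥ →
      subst (B ℚ.* ℚ.∣ s m ℚ.- s n ∣ ℚ.<_) Bδ≡ε (ℚ.*-monoʳ-<-pos B (hs m n m≥ n≥))

  *-estimate : ∀ {A B ε} a b c d →
               ℚ.∣ a ∣ ℚ.≤ A → ℚ.∣ d ∣ ℚ.≤ B →
               A ℚ.* ℚ.∣ b ℚ.- d ∣ ℚ.< ½ ℚ.* ε → B ℚ.* ℚ.∣ a ℚ.- c ∣ ℚ.< ½ ℚ.* ε →
               ℚ.∣ a ℚ.* b ℚ.- c ℚ.* d ∣ ℚ.< ε
  *-estimate {A} {B} {ε} a b c d a≤A d≤B h k = begin-strict
    ℚ.∣ a ℚ.* b ℚ.- c ℚ.* d ∣
      ≡⟨ cong ℚ.∣_∣ (lemma a b c d) ⟩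
    ℚ.∣ a ℚ.* (b ℚ.- d) ℚ.+ d ℚ.* (a ℚ.- c) ∣
      ≤⟨ ℚ.∣p+q∣≤∣p∣+∣q∣ (a ℚ.* (b ℚ.- d)) (d ℚ.* (a ℚ.- c)) ⟩
    ℚ.∣ a ℚ.* (b ℚ.- d) ∣ ℚ.+ ℚ.∣ d ℚ.* (a ℚ.- c) ∣
      ≡⟨ cong₂ ℚ._+_ (ℚ.∣p*q∣≡∣p∣*∣q∣ a (b ℚ.- d)) (ℚ.∣p*q∣≡∣p∣*∣q∣ d (a ℚ.- c)) ⟩
    ℚ.∣ a ∣ ℚ.* ℚ.∣ b ℚ.- d ∣ ℚ.+ ℚ.∣ d ∣ ℚ.* ℚ.∣ a ℚ.- c ∣
      ≤⟨ ℚ.+-mono-≤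
           (ℚ.*-monoʳ-≤-nonNeg ℚ.∣ b ℚ.- d ∣ {{ℚ.∣-∣-nonNeg (b ℚ.- d)}} a≤A)
           (ℚ.*-monoʳ-≤-nonNeg ℚ.∣ a ℚ.- c ∣ {{ℚ.∣-∣-nonNeg (a ℚ.- c)}} d≤B) ⟩
    A ℚ.* ℚ.∣ b ℚ.- d ∣ ℚ.+ B ℚ.* ℚ.∣ a ℚ.- c ∣
      <⟨ ℚ.+-mono-< h k ⟩
    ½ ℚ.* ε ℚ.+ ½ ℚ.* ε
      ≡⟨ half+half ε ⟩
    ε ∎
    where
    open ℚ.≤-Reasoning
    open +-*-Solver
    lemma : ∀ a b c d → a ℚ.* b ℚ.- c ℚ.* d ≡ a ℚ.* (b ℚ.- d) ℚ.+ d ℚ.* (a ℚ.- c)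
    lemma = solve 4 (λ a b c d → a :* b :- c :* d := a :* (b :- d) :+ d :* (a :- c)) refl

  *-cauchy : ∀ {s t} → IsCauchy s → IsCauchy t → IsCauchy (λ k → s k ℚ.* t k)
  *-cauchy {s} {t} cs ct ε 0<ε =
    let A , 0<A , K , hA = bounded {s} cs
        B , 0<B , L , hB = bounded {t} ct
        M , ht = scaled {t} ct 0<A (half {ε} 0<ε)
        N , hs = scaled {s} cs 0<B (half {ε} 0<ε)
    in join-bounds {A} {B} K L M N hA hB ht hs
    where
    join-bounds : ∀ {A B} K L M N →
      (∀ n → K ℕ.≤ n → ℚ.∣ s n ∣ ℚ.≤ A) →
      (∀ n → L ℕ.≤ n → ℚ.∣ t n ∣ ℚ.≤ B) →
      (∀ m n → M ℕ.≤ m → M ℕ.≤ n → A ℚ.* ℚ.∣ t m ℚ.- t n ∣ ℚ.< ½ ℚ.* ε) →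
      (∀ m n → N ℕ.≤ m → N ℕ.≤ n → B ℚ.* ℚ.∣ s m ℚ.- s n ∣ ℚ.< ½ ℚ.* ε) →
      ∃ λ P → ∀ m n → P ℕ.≤ m → P ℕ.≤ n → ℚ.∣ s m ℚ.* t m ℚ.- s n ℚ.* t n ∣ ℚ.< ε
    join-bounds {A} {B} K L M N hA hB ht hs = (K ℕ.⊔ L) ℕ.⊔ (M ℕ.⊔ N) , λ m n m≥ n≥ →
      let KL≤m = ℕ.m⊔n≤o⇒m≤o (K ℕ.⊔ L) (M ℕ.⊔ N) m≥
          KL≤n = ℕ.m⊔n≤o⇒m≤o (K ℕ.⊔ L) (M ℕ.⊔ N) n≥
          MN≤m = ℕ.m⊔n≤o⇒n≤o (K ℕ.⊔ L) (M ℕ.⊔ N) m≥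
          MN≤n = ℕ.m⊔n≤o⇒n≤o (K ℕ.⊔ L) (M ℕ.⊔ N) n≥
      in *-estimate {A} {B} {ε} (s m) (t m) (s n) (t n)
           (hA m (ℕ.m⊔n≤o⇒m≤o K L KL≤m))
           (hB n (ℕ.m⊔n≤o⇒n≤o K L KL≤n))
           (ht m n (ℕ.m⊔n≤o⇒m≤o M N MN≤m) (ℕ.m⊔n≤o⇒m≤o M N MN≤n))
           (hs m n (ℕ.m⊔n≤o⇒n≤o M N MN≤m) (ℕ.m⊔n≤o⇒n≤o M N MN≤n))

  const-cauchy : ∀ q → IsCauchy (λ _ → q)
  const-cauchy q ε 0<ε = 0 , λ _ _ _ _ → subst (ℚ._< ε) (sym (cong ℚ.∣_∣ (ℚ.+-inverseʳ q))) 0<ε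

fromℚ : ℚ → ℝ
fromℚ q = mkℝ (λ _ → q) (const-cauchy q)

0ℝ 1ℝ : ℝ
0ℝ = fromℚ 0ℚ
1ℝ = fromℚ 1ℚ

infixl 6 _+_ _-_
infixl 7 _*_
infix  8 -_
infix  4 _≈_ _<_ _≤_

_+_ _*_ : ℝ → ℝ → ℝ
x + y = mkℝ (λ k → seq x k ℚ.+ seq y k) (+-cauchy {seq x} {seq y} (cauchy x) (cauchy y))
x * y = mkℝ (λ k → seq x k ℚ.* seq y k) (*-cauchy {seq x} {seq y} (cauchy x) (cauchy y))

-_ : ℝ → ℝ
- x = mkℝ (λ k → ℚ.- seq x k) (neg-cauchy {seq x} (cauchy x))

_-_ : ℝ → ℝ → ℝ
x - y = x + (- y)

abs : ℝ → ℝ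
abs x = mkℝ (λ k → ℚ.∣ seq x k ∣) (∣∣-cauchy {seq x} (cauchy x))

_≈_ : ℝ → ℝ → Set
x ≈ y = ∀ ε → 0ℚ ℚ.< ε → ∃ λ N → ∀ n → N ℕ.≤ n → ℚ.∣ seq x n ℚ.- seq y n ∣ ℚ.< ε

_<_ : ℝ → ℝ → Set
x < y = ∃ λ ε → 0ℚ ℚ.< ε × ∃ λ N → ∀ n → N ℕ.≤ n → seq x n ℚ.+ ε ℚ.≤ seq y n

_≤_ : ℝ → ℝ → Set
x ≤ y = ¬ (y < x)

∑ : ∀ {n} → Vector ℝ n → ℝ
∑ = foldr _+_ 0ℝ

------------------------------------------------------------------------
-- The metric d is presented by the relations
-- Ball ε x y, meaning d(x,y) < ε, for rational ε; points at distance 0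
-- are identified by _≋_.

record MetricSpace : Set₁ where
  field
    Carrier  : Set
    Ball     : ℚ → Carrier → Carrier → Set
    refl-b   : ∀ {ε x} → 0ℚ ℚ.< ε → Ball ε x x
    sym-b    : ∀ {ε x y} → Ball ε x y → Ball ε y x
    triangle : ∀ {ε δ x y z} → Ball ε x y → Ball δ y z → Ball (ε ℚ.+ δ) x z

  _≋_ : Carrier → Carrier → Set
  x ≋ y = ∀ ε → 0ℚ ℚ.< ε → Ball ε x y

∣_∣ₛ : MetricSpace → Set
∣ X ∣ₛ = MetricSpace.Carrier X

ℝ-space : MetricSpace
ℝ-space = record
  { Carrier  = ℝ
  ; Ball     = λ ε x y → abs (x - y) < fromℚ ε
  ; refl-b   = λ {ε} {x} 0<ε → ε , 0<ε , 0 , λ n _ → ℚ.≤-reflexive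
      (trans (cong (λ r → ℚ.∣ r ∣ ℚ.+ ε) (ℚ.+-inverseʳ (seq x n))) (ℚ.+-identityˡ ε))
  ; sym-b    = λ {ε} {x} {y} (η , 0<η , N , h) → η , 0<η , N , λ n n≥ →
      subst (λ r → r ℚ.+ η ℚ.≤ ε) (∣p-q∣≡∣q-p∣ (seq x n) (seq y n)) (h n n≥)
  ; triangle = λ {ε} {δ} {x} {y} {z} → tri ε δ x y z
  }
  where
  tri : ∀ ε δ x y z → abs (x - y) < fromℚ ε → abs (y - z) < fromℚ δ →
        abs (x - z) < fromℚ (ε ℚ.+ δ)
  tri ε δ x y z (η , 0<η , M , h) (θ , 0<θ , N , k) =
    η ℚ.+ θ , ℚ.+-mono-< 0<η 0<θ , M ℕ.⊔ N , λ n n≥ → begin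
      ℚ.∣ seq x n ℚ.- seq z n ∣ ℚ.+ (η ℚ.+ θ)
        ≡⟨ cong (λ r → ℚ.∣ r ∣ ℚ.+ (η ℚ.+ θ)) (lemma (seq x n) (seq y n) (seq z n)) ⟩
      ℚ.∣ (seq x n ℚ.- seq y n) ℚ.+ (seq y n ℚ.- seq z n) ∣ ℚ.+ (η ℚ.+ θ)
        ≤⟨ ℚ.+-monoˡ-≤ (η ℚ.+ θ) (ℚ.∣p+q∣≤∣p∣+∣q∣ (seq x n ℚ.- seq y n) (seq y n ℚ.- seq z n)) ⟩
      (ℚ.∣ seq x n ℚ.- seq y n ∣ ℚ.+ ℚ.∣ seq y n ℚ.- seq z n ∣) ℚ.+ (η ℚ.+ θ)
        ≡⟨ lemma′ ℚ.∣ seq x n ℚ.- seq y n ∣ ℚ.∣ seq y n ℚ.- seq z n ∣ η θ ⟩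
      (ℚ.∣ seq x n ℚ.- seq y n ∣ ℚ.+ η) ℚ.+ (ℚ.∣ seq y n ℚ.- seq z n ∣ ℚ.+ θ)
        ≤⟨ ℚ.+-mono-≤ (h n (ℕ.m⊔n≤o⇒m≤o M N n≥)) (k n (ℕ.m⊔n≤o⇒n≤o M N n≥)) ⟩
      ε ℚ.+ δ ∎
    where
    open ℚ.≤-Reasoning
    open +-*-Solver
    lemma : ∀ a b c → a ℚ.- c ≡ (a ℚ.- b) ℚ.+ (b ℚ.- c)
    lemma = solve 3 (λ a b c → a :- c := (a :- b) :+ (b :- c)) refl
    lemma′ : ∀ a b c d → (a ℚ.+ b) ℚ.+ (c ℚ.+ d) ≡ (a ℚ.+ c) ℚ.+ (b ℚ.+ d)
    lemma′ = solve 4 (λ a b c d → (a :+ b) :+ (c :+ d) := (a :+ c) :+ (b :+ d)) refl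

-- Powers and products carry the maximum metric, which induces the
-- product topology.
_^ₛ_ : MetricSpace → ℕ → MetricSpace
X ^ₛ n = record
  { Carrier  = Vector Carrier n
  ; Ball     = λ ε x y → ∀ i → Ball ε (x i) (y i)
  ; refl-b   = λ 0<ε i → refl-b 0<ε
  ; sym-b    = λ b i → sym-b (b i)
  ; triangle = λ b c i → triangle (b i) (c i)
  }
  where open MetricSpace X

_×ₛ_ : MetricSpace → MetricSpace → MetricSpace
X ×ₛ Y = record
  { Carrier  = X.Carrier × Y.Carrier
  ; Ball     = λ ε (x , y) (x′ , y′) → X.Ball ε x x′ × Y.Ball ε y y′
  ; refl-b   = λ 0<ε → X.refl-b 0<ε , Y.refl-b 0<ε
  ; sym-b    = λ (b , c) → X.sym-b b , Y.sym-b c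
  ; triangle = λ (b , c) (b′ , c′) → X.triangle b b′ , Y.triangle c c′
  }
  where
  module X = MetricSpace X
  module Y = MetricSpace Y

Subspace : (X : MetricSpace) → (∣ X ∣ₛ → Set) → MetricSpace
Subspace X P = record
  { Carrier  = Σ Carrier P
  ; Ball     = λ ε x y → Ball ε (proj₁ x) (proj₁ y)
  ; refl-b   = refl-b
  ; sym-b    = sym-b
  ; triangle = triangle
  }
  where open MetricSpace X

Continuous : (X Y : MetricSpace) → (∣ X ∣ₛ → ∣ Y ∣ₛ) → Set
Continuous X Y f = ∀ x ε → 0ℚ ℚ.< ε → ∃ λ δ → 0ℚ ℚ.< δ ×
  (∀ x′ → MetricSpace.Ball X δ x x′ → MetricSpace.Ball Y ε (f x) (f x′))

-- Preservation of _≋_ needs no separate clause: it follows from continuity.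
record _⟶_ (X Y : MetricSpace) : Set where
  field
    fun        : ∣ X ∣ₛ → ∣ Y ∣ₛ
    continuous : Continuous X Y fun

open _⟶_ public

I : MetricSpace
I = Subspace ℝ-space (λ t → 0ℝ ≤ t × t ≤ 1ℝ)

private
  q≮q : ∀ {q} → ¬ (fromℚ q < fromℚ q)
  q≮q {q} (ε , 0<ε , N , h) = ℚ.<-irrefl refl
    (ℚ.<-≤-trans (subst (ℚ._< q ℚ.+ ε) (ℚ.+-identityʳ q) (ℚ.+-monoʳ-< q 0<ε)) (h N ℕ.≤-refl))

  1≮0 : ¬ (1ℝ < 0ℝ)
  1≮0 (ε , 0<ε , N , h) = ℚ.<-irrefl refl
    (ℚ.<-≤-trans (ℚ.+-mono-< (ℚ.positive⁻¹ 1ℚ) 0<ε) (h N ℕ.≤-refl))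

0ᴵ 1ᴵ : ∣ I ∣ₛ
0ᴵ = 0ℝ , q≮q , 1≮0
1ᴵ = 1ℝ , 1≮0 , q≮q

record Homotopy {X Y : MetricSpace} (f g : ∣ X ∣ₛ → ∣ Y ∣ₛ) : Set where
  open MetricSpace Y using (_≋_)
  field
    map   : (X ×ₛ I) ⟶ Y
    start : ∀ x → fun map (x , 0ᴵ) ≋ f x
    end   : ∀ x → fun map (x , 1ᴵ) ≋ g x

infix 4 _≃_

record _≃_ (X Y : MetricSpace) : Set where
  field
    to      : X ⟶ Y
    from    : Y ⟶ X
    from∘to : Homotopy {X} {X} (fun from ∘ fun to) id
    to∘from : Homotopy {Y} {Y} (fun to ∘ fun from) id

Sphere : ℕ → MetricSpace
Sphere k = Subspace (ℝ-space ^ₛ suc k) (λ x → ∑ (λ i → x i * x i) ≈ 1ℝ)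

------------------------------------------------------------------------

record Complex : Set₁ where
  field
    size   : ℕ
    Face   : Subset size → Set
    empty  : Face ⊥
    vertex : ∀ v → Face ⁅ v ⁆
    down   : ∀ {σ τ} → σ ⊆ τ → Face τ → Face σ

-- Barycentric coordinates whose support is a face.  As positivity of a
-- real is not decidable, the support is not available as a `Subset`;
-- "the support is a face" therefore reads: every set of vertices on which
-- the coordinates are positive is a face.
Realisation : Complex → MetricSpace
Realisation K = Subspace (ℝ-space ^ₛ size) λ x →
  (∀ v → 0ℝ ≤ x v) ×
  (∑ x ≈ 1ℝ) ×
  (∀ σ → (∀ {v} → v ∈ σ → 0ℝ < x v) → Face σ)
  where open Complex K

------------------------------------------------------------------------

record Graph : Set where
  field
    #V #E     : ℕ
    end₁ end₂ : Fin #E → Fin #V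
    loopless  : ∀ e → end₁ e ≢ end₂ e
    simple    : ∀ e f →
      (end₁ e ≡ end₁ f × end₂ e ≡ end₂ f) ⊎ (end₁ e ≡ end₂ f × end₂ e ≡ end₁ f) →
      e ≡ f

  incident : Fin #V → Subset #E
  incident v = tabulate λ e → does ((end₁ e ≟ v) ⊎-dec (end₂ e ≟ v))

  degreeIn : Subset #E → Fin #V → ℕ
  degreeIn M v = ∣ M ∩ incident v ∣

  Is2Matching : Subset #E → Set
  Is2Matching M = ∀ v → degreeIn M v ℕ.≤ 2

M₂ : Graph → Complex
M₂ G = record
  { size   = #E
  ; Face   = Is2Matching
  ; empty  = λ v → ℕ.≤-trans (∣p∩q∣≤∣p∣ ⊥ (incident v))
                     (ℕ.≤-trans (ℕ.≤-reflexive (∣⊥∣≡0 #E)) z≤n)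
  ; vertex = λ e v → ℕ.≤-trans (∣p∩q∣≤∣p∣ ⁅ e ⁆ (incident v))
                       (ℕ.≤-trans (ℕ.≤-reflexive (∣⁅x⁆∣≡1 e)) (s≤s z≤n))
  ; down   = λ {σ} {τ} σ⊆τ h v → ℕ.≤-trans
      (p⊆q⇒∣p∣≤∣q∣ λ x∈ → let x∈σ , x∈v = x∈p∩q⁻ σ (incident v) x∈
                          in x∈p∩q⁺ (σ⊆τ x∈σ , x∈v))
      (h v)
  }
  where open Graph G

next : ∀ {n} .{{_ : NonZero n}} → Fin n → Fin n
next {n} i = suc (toℕ i) mod n

private
  next-cases : ∀ {n} .{{_ : NonZero n}} (i : Fin n) →
    toℕ (next i) ≡ suc (toℕ i) ⊎ (toℕ (next i) ≡ 0 × suc (toℕ i) ≡ n)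
  next-cases {n} i with ℕ.m≤n⇒m<n∨m≡n (toℕ<n i)
  ... | inj₁ lt = inj₁ (trans (toℕ-fromℕ< (m%n<n (suc (toℕ i)) n)) (m<n⇒m%n≡m lt))
  ... | inj₂ eq = inj₂ ( trans (toℕ-fromℕ< (m%n<n (suc (toℕ i)) n))
                               (trans (cong (_% n) eq) (n%n≡0 n))
                       , eq)

  next≢ : ∀ {n} .{{_ : NonZero n}} → 3 ℕ.≤ n → (i : Fin n) → i ≢ next i
  next≢ 3≤n i i≡ with next-cases i
  ... | inj₁ eq = ℕ.1+n≢n (trans (sym eq) (cong toℕ (sym i≡)))
  ... | inj₂ (eq , 1+i≡n) with trans (cong toℕ i≡) eq
  ... | i≡0 with subst (3 ℕ.≤_) (trans (sym 1+i≡n) (cong suc i≡0)) 3≤n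
  ... | s≤s ()

  next² : ∀ {n} .{{_ : NonZero n}} → 3 ℕ.≤ n → (i j : Fin n) → i ≡ next j → next i ≢ j
  next² 3≤n i j i≡ ≡j with next-cases j | next-cases i
  ... | inj₁ a | inj₁ b = ℕ.m+1+n≢n 1 (trans (sym (cong suc (trans (cong toℕ i≡) a)))
                            (trans (sym b) (cong toℕ ≡j)))
  ... | inj₁ a | inj₂ (b , c)
      with subst (3 ℕ.≤_) (trans (sym c) (cong suc (trans (trans (cong toℕ i≡) a)
             (cong suc (trans (sym (cong toℕ ≡j)) b))))) 3≤n
  ... | s≤s (s≤s ())
  next² 3≤n i j i≡ ≡j | inj₂ (a , c) | inj₁ b
      with subst (3 ℕ.≤_) (trans (sym c) (cong suc (trans (trans (sym (cong toℕ ≡j)) b)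
             (cong suc (trans (cong toℕ i≡) a))))) 3≤n
  ... | s≤s (s≤s ())
  next² 3≤n i j i≡ ≡j | inj₂ (a , c) | inj₂ (b , d)
      with subst (3 ℕ.≤_) (trans (sym d) (cong suc (trans (cong toℕ i≡) a))) 3≤n
  ... | s≤s ()

cycle : ∀ n → 3 ℕ.≤ n → Graph
cycle n 3≤n = record
  { #V       = n
  ; #E       = n
  ; end₁     = id
  ; end₂     = next
  ; loopless = next≢ 3≤n
  ; simple   = λ where
      e f (inj₁ (e≡f , _)) → e≡f
      e f (inj₂ (p , q))   → ⊥-elim (next² 3≤n e f p q)
  }
  where instance
    n-nonZero : NonZero n
    n-nonZero = ℕ.>-nonZero (ℕ.≤-trans (s≤s z≤n) 3≤n)

-- The vertices `v ↑ˡ #V` are those of G, and `#V ↑ʳ v` is the leaf at v;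
-- likewise the edges are those of G followed by the whiskers.
whiskered : Graph → Graph
whiskered G = record
  { #V       = #V ℕ.+ #V
  ; #E       = #E ℕ.+ #V
  ; end₁     = a ∘ splitAt #E
  ; end₂     = b ∘ splitAt #E
  ; loopless = λ e → loopless′ (splitAt #E e)
  ; simple   = λ e f h →
      trans (sym (join-splitAt #E #V e))
        (trans (cong (join #E #V) (simple′ (splitAt #E e) (splitAt #E f) h))
               (join-splitAt #E #V f))
  }
  where
  open Graph G

  a b : Fin #E ⊎ Fin #V → Fin (#V ℕ.+ #V)
  a = [ (λ e → end₁ e ↑ˡ #V) , (λ v → v ↑ˡ #V) ]′
  b = [ (λ e → end₂ e ↑ˡ #V) , (λ v → #V ↑ʳ v) ]′

  l≢r : ∀ {u v} → u ↑ˡ #V ≢ #V ↑ʳ v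
  l≢r {u} {v} eq with trans (sym (splitAt-↑ˡ #V u #V))
                       (trans (cong (splitAt #V) eq) (splitAt-↑ʳ #V #V v))
  ... | ()

  inj : ∀ {u v : Fin #V} → u ↑ˡ #V ≡ v ↑ˡ #V → u ≡ v
  inj {u} {v} = ↑ˡ-injective #V u v

  loopless′ : ∀ x → a x ≢ b x
  loopless′ (inj₁ e) eq = loopless e (inj eq)
  loopless′ (inj₂ v) eq = l≢r eq

  simple′ : ∀ x y → (a x ≡ a y × b x ≡ b y) ⊎ (a x ≡ b y × b x ≡ a y) → x ≡ y
  simple′ (inj₁ e) (inj₁ f) (inj₁ (p , q)) = cong inj₁ (simple e f (inj₁ (inj p , inj q)))
  simple′ (inj₁ e) (inj₁ f) (inj₂ (p , q)) = cong inj₁ (simple e f (inj₂ (inj p , inj q)))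
  simple′ (inj₁ e) (inj₂ w) (inj₁ (p , q)) = ⊥-elim (l≢r q)
  simple′ (inj₁ e) (inj₂ w) (inj₂ (p , q)) = ⊥-elim (l≢r p)
  simple′ (inj₂ v) (inj₁ f) (inj₁ (p , q)) = ⊥-elim (l≢r (sym q))
  simple′ (inj₂ v) (inj₁ f) (inj₂ (p , q)) = ⊥-elim (l≢r (sym q))
  simple′ (inj₂ v) (inj₂ w) (inj₁ (p , q)) = cong inj₂ (inj p)
  simple′ (inj₂ v) (inj₂ w) (inj₂ (p , q)) = ⊥-elim (l≢r p)

{-# OPTIONS --safe #-}

-- Let x i be the coordinate of the i-th cycle edge and y i that of the i-th whisker.  The minimal
-- non-faces are {x j, x (j+1), y (j+1)}, so the complex contains the boundary of the cross-polytope
-- (never both x i and y i), which is the sphere: a vector z gives x = z⁺, y = z⁻ up to scale.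
-- A retraction to that boundary is x i - y i - Σⱼ 2 min(x j, y j), rescaled.  It is nowhere zero: if
-- some x j vanishes, all entries being zero forces every min, hence every y and x, to vanish; if no
-- x j does, then y = 0.  Letting W i = x i - (1-t)(y i + Σⱼ 2 min(x j, y j)), the points
-- (2 W⁺, 2 W⁻ + 2 t y), rescaled, deform the retraction to the identity inside the complex, because
-- W i > 0 only where x i > 0.
-- As ≤ on reals is a negation, it may be proved by classical case distinctions; the explicit bound
-- 1 ≤ (3n+2) Σ (|W i| + 2 t y i) makes the rescaling constructive.  Inverses and square roots
-- both come from the single function ρ x = 1/√max(x, 1).

module Submission where

import Algebra.Properties.Semiring.Sum as SemiringSum
import Algebra.Solver.Ring as RingSolver
open import Algebra.Bundles using (CommutativeRing)
open import Algebra.Solver.Ring.AlmostCommutativeRing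
  using (fromCommutativeRing; _-Raw-AlmostCommutative⟶_)
open import Algebra.Structures using (IsCommutativeRing)
open import Data.Empty using (⊥; ⊥-elim)
open import Data.Fin.Base using (Fin; zero; suc; splitAt; _↑ˡ_; _↑ʳ_)
open import Data.Fin.Properties using (splitAt-↑ˡ; splitAt-↑ʳ; splitAt⁻¹-↑ˡ; splitAt⁻¹-↑ʳ)
open import Data.Maybe.Base using (Maybe; just; nothing)
open import Data.Nat.Base as ℕ using (zero; suc)
import Data.Nat.Properties as ℕ
open import Data.Product.Base using (∃; _×_; _,_; proj₁; proj₂)
open import Data.Rational.Base as ℚ using (ℚ; 0ℚ; 1ℚ; ½; mkℚ)
import Data.Rational.Properties as ℚ
open import Data.Sum.Base using (_⊎_; inj₁; inj₂; [_,_]′)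
open import Data.Vec.Functional using (Vector)
open import Function.Base using (_∘_; id)
open import Level using (0ℓ)
open import Relation.Binary.PropositionalEquality as ≡ using (_≡_; _≢_)
open import Relation.Nullary using (Dec; yes; no; does)
open import Data.Nat.Base using (ℕ)
open import Relation.Nullary.Negation.Core using (¬_)

-- The deformation respects the face condition for a local reason. If the deformed coordinates of
-- the cycle edges j and j+1 are both nonzero, then so were x j and x (j+1), hence y (j+1) = 0;
-- moreover W (j+1) ≥ 0, so its negative part adds nothing to the whisker at j+1. The term 2 t y
-- restores the whisker coordinates at t = 1, where W is just x. On the sphere side the homotopy is
-- stationary: if x and y are proportional to z⁺ and z⁻, then every min(x j, y j) vanishes and the
-- rescaled retraction returns z itself. The constructive obstacle is that a vector which is merely
-- nowhere zero cannot be rescaled; a positive lower bound is required. Vectors that might be small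
-- are therefore first multiplied by a fixed constant, so that their sum, or sum of squares, is at
-- least 1. The algebra is carried out over an abstract ordered ring, so that the ring solver and
-- the conversion checker never meet Cauchy sequences and their moduli.

-- Ordered rings with inverse square roots.

record OrderedRing : Set₁ where
  infixl 6 _+_
  infixl 7 _*_
  infix  8 -_
  infix  4 _≈_ _≤_
  field
    Carrier : Set
    _≈_ _≤_ : Carrier → Carrier → Set
    _+_ _*_ : Carrier → Carrier → Carrier
    -_ ∣_∣ ρ : Carrier → Carrier
    ι       : ℚ → Carrier
    isCommutativeRing : IsCommutativeRing _≈_ _+_ _*_ -_ (ι 0ℚ) (ι 1ℚ)
    ι-+ : ∀ p q → ι (p ℚ.+ q) ≈ ι p + ι q
    ι-* : ∀ p q → ι (p ℚ.* q) ≈ ι p * ι q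
    ι-neg : ∀ p → ι (ℚ.- p) ≈ - ι p

  commutativeRing : CommutativeRing 0ℓ 0ℓ
  commutativeRing = record { isCommutativeRing = isCommutativeRing }

  open CommutativeRing commutativeRing public
    hiding (Carrier; _≈_; _+_; _*_; -_; isCommutativeRing; zero)

  field
    ≤-reflexive : ∀ {x y} → x ≈ y → x ≤ y
    ≤-trans     : ∀ {x y z} → x ≤ y → y ≤ z → x ≤ z
    ≤-antisym   : ∀ {x y} → x ≤ y → y ≤ x → x ≈ y
    -- The order is not decidable. This field and the next admit classical reasoning exactly when
    -- the goal is itself an inequality.
    ≤-cases     : ∀ {a b} x y → (x ≤ y → a ≤ b) → (y ≤ x → a ≤ b) → a ≤ b
    ≤-stable    : ∀ {x y} → ¬ ¬ (x ≤ y) → x ≤ y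
    x≤y⇒0≤y-x   : ∀ {x y} → x ≤ y → 0# ≤ y - x
    0≤y-x⇒x≤y   : ∀ {x y} → 0# ≤ y - x → x ≤ y
    +-nonneg    : ∀ {x y} → 0# ≤ x → 0# ≤ y → 0# ≤ x + y
    *-nonneg    : ∀ {x y} → 0# ≤ x → 0# ≤ y → 0# ≤ x * y
    0≤1#        : 0# ≤ 1#
    abs-cong    : ∀ {x y} → x ≈ y → ∣ x ∣ ≈ ∣ y ∣
    abs-nonneg  : ∀ x → 0# ≤ ∣ x ∣
    abs-neg     : ∀ x → ∣ - x ∣ ≈ ∣ x ∣
    abs-*       : ∀ x y → ∣ x * y ∣ ≈ ∣ x ∣ * ∣ y ∣
    abs-square  : ∀ x → ∣ x ∣ * ∣ x ∣ ≈ x * x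
    x≤∣x∣       : ∀ x → x ≤ ∣ x ∣
    0≤x⇒∣x∣≈x   : ∀ {x} → 0# ≤ x → ∣ x ∣ ≈ x
    ρ-cong      : ∀ {x y} → x ≈ y → ρ x ≈ ρ y
    ρ-nonneg    : ∀ x → 0# ≤ ρ x
    ρ²x≈1       : ∀ {x} → 1# ≤ x → (ρ x * ρ x) * x ≈ 1#

-- The retraction and the deformation over an ordered ring.

module Vectors (R : OrderedRing) where
  open OrderedRing R public
  open SemiringSum semiring public using (sum-cong-≋; ∑-distrib-+; *-distribˡ-sum; *-distribʳ-sum)
  open SemiringSum semiring using (sum)

  morphism : ℚ.+-*-rawRing -Raw-AlmostCommutative⟶ fromCommutativeRing commutativeRing
  morphism = record
    { ⟦_⟧ = ι ; +-homo = ι-+ ; *-homo = ι-* ; -‿homo = ι-neg ; 0-homo = refl ; 1-homo = refl }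

  ι-≟ : ∀ p q → Maybe (ι p ≈ ι q)
  ι-≟ p q with p ℚ.≟ q
  ... | yes ≡.refl = just refl
  ... | no _       = nothing

  open RingSolver ℚ.+-*-rawRing (fromCommutativeRing commutativeRing) morphism ι-≟ public
    using (solve; con; _:+_; _:*_; :-_; _:-_; _:=_)

  infixr 1 _∙_
  _∙_ : ∀ {x y z} → x ≈ y → y ≈ z → x ≈ z
  _∙_ = trans

  ∑ : ∀ {n} → Vector Carrier n → Carrier
  ∑ = sum

  -- Reduces an inequality to a ring identity: the difference is written as a combination `r` of
  -- known nonnegative quantities, and the solver checks the rest.
  ≤-witness : ∀ {x y} r → 0# ≤ r → y - x ≈ r → x ≤ y
  ≤-witness r 0≤r eq = 0≤y-x⇒x≤y (≤-trans 0≤r (≤-reflexive (sym eq)))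

  ≤-refl : ∀ {x} → x ≤ x
  ≤-refl = ≤-reflexive refl

  +-mono-≤ : ∀ {a b c d} → a ≤ b → c ≤ d → a + c ≤ b + d
  +-mono-≤ {a} {b} {c} {d} p q = ≤-witness _ (+-nonneg (x≤y⇒0≤y-x p) (x≤y⇒0≤y-x q))
    (solve 4 (λ a b c d → (b :+ d) :- (a :+ c) := (b :- a) :+ (d :- c)) refl a b c d)

  *-monoʳ-≤ : ∀ {a b} c → 0# ≤ c → a ≤ b → c * a ≤ c * b
  *-monoʳ-≤ {a} {b} c 0≤c p = ≤-witness _ (*-nonneg 0≤c (x≤y⇒0≤y-x p))
    (solve 3 (λ a b c → c :* b :- c :* a := c :* (b :- a)) refl a b c)

  -x≤∣x∣ : ∀ x → - x ≤ ∣ x ∣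
  -x≤∣x∣ x = ≤-trans (x≤∣x∣ (- x)) (≤-reflexive (abs-neg x))

  0≤-x : ∀ {x} → x ≤ 0# → 0# ≤ - x
  0≤-x {x} x≤0 = ≤-trans (x≤y⇒0≤y-x x≤0) (≤-reflexive (+-identityˡ (- x)))

  x≤0⇒∣x∣≈-x : ∀ {x} → x ≤ 0# → ∣ x ∣ ≈ - x
  x≤0⇒∣x∣≈-x {x} x≤0 = sym (abs-neg x) ∙ 0≤x⇒∣x∣≈x (0≤-x x≤0)

  ∣x∣≤y : ∀ {x y} → x ≤ y → - x ≤ y → ∣ x ∣ ≤ y
  ∣x∣≤y {x} x≤y -x≤y = ≤-cases 0# x
    (λ 0≤x → ≤-trans (≤-reflexive (0≤x⇒∣x∣≈x 0≤x)) x≤y)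
    (λ x≤0 → ≤-trans (≤-reflexive (x≤0⇒∣x∣≈-x x≤0)) -x≤y)

  square-nonneg : ∀ x → 0# ≤ x * x
  square-nonneg x = ≤-trans (*-nonneg (abs-nonneg x) (abs-nonneg x)) (≤-reflexive (abs-square x))

  -- If u ≤ 1, then 1 ≤ u² ≤ u; the other case is the goal.
  1≤u²⇒1≤u : ∀ {u} → 0# ≤ u → 1# ≤ u * u → 1# ≤ u
  1≤u²⇒1≤u {u} 0≤u 1≤u² = ≤-cases u 1#
    (λ u≤1 → ≤-trans 1≤u² (≤-trans (*-monoʳ-≤ u 0≤u u≤1) (≤-reflexive (*-identityʳ u))))
    id

  u²≈1⇒u≈1 : ∀ {u} → 0# ≤ u → u * u ≈ 1# → u ≈ 1#
  u²≈1⇒u≈1 {u} 0≤u u²≈1 = ≤-antisym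
    (≤-trans (≤-reflexive (sym (*-identityʳ u)))
      (≤-trans (*-monoʳ-≤ u 0≤u 1≤u) (≤-reflexive u²≈1)))
    1≤u
    where 1≤u = 1≤u²⇒1≤u 0≤u (≤-reflexive (sym u²≈1))

  -- Twice the positive and negative parts, to avoid division by 2.

  pos neg : Carrier → Carrier
  pos z = ∣ z ∣ + z
  neg z = ∣ z ∣ - z

  pos-nonneg : ∀ z → 0# ≤ pos z
  pos-nonneg z = ≤-trans (x≤y⇒0≤y-x (-x≤∣x∣ z))
    (≤-reflexive (solve 2 (λ a z → a :- (:- z) := a :+ z) refl ∣ z ∣ z))

  neg-nonneg : ∀ z → 0# ≤ neg z
  neg-nonneg z = x≤y⇒0≤y-x (x≤∣x∣ z)

  z≤0⇒pos≈0 : ∀ {z} → z ≤ 0# → pos z ≈ 0#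
  z≤0⇒pos≈0 {z} z≤0 = +-congʳ (x≤0⇒∣x∣≈-x z≤0) ∙ -‿inverseˡ z

  0≤z⇒neg≈0 : ∀ {z} → 0# ≤ z → neg z ≈ 0#
  0≤z⇒neg≈0 {z} 0≤z = +-congʳ (0≤x⇒∣x∣≈x 0≤z) ∙ -‿inverseʳ z

  pos-cong : ∀ {x y} → x ≈ y → pos x ≈ pos y
  pos-cong x≈y = +-cong (abs-cong x≈y) x≈y

  neg-cong : ∀ {x y} → x ≈ y → neg x ≈ neg y
  neg-cong x≈y = +-cong (abs-cong x≈y) (-‿cong x≈y)

  abs-scale : ∀ {a} z → 0# ≤ a → ∣ a * z ∣ ≈ a * ∣ z ∣
  abs-scale {a} z 0≤a = abs-* a z ∙ *-congʳ (0≤x⇒∣x∣≈x 0≤a)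

  pos-scale : ∀ {a} z → 0# ≤ a → pos (a * z) ≈ a * pos z
  pos-scale {a} z 0≤a = +-congʳ (abs-scale z 0≤a) ∙ sym (distribˡ a ∣ z ∣ z)

  neg-scale : ∀ {a} z → 0# ≤ a → neg (a * z) ≈ a * neg z
  neg-scale {a} z 0≤a = +-congʳ (abs-scale z 0≤a)
    ∙ solve 3 (λ a b z → a :* b :- a :* z := a :* (b :- z)) refl a ∣ z ∣ z

  -- Sums

  ∑-mono-≤ : ∀ {n} {f g : Vector Carrier n} → (∀ i → f i ≤ g i) → ∑ f ≤ ∑ g
  ∑-mono-≤ {ℕ.zero}  h = ≤-refl
  ∑-mono-≤ {ℕ.suc n} h = +-mono-≤ (h zero) (∑-mono-≤ (h ∘ suc))

  ∑-nonneg : ∀ {n} {f : Vector Carrier n} → (∀ i → 0# ≤ f i) → 0# ≤ ∑ f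
  ∑-nonneg {ℕ.zero}  h = ≤-refl
  ∑-nonneg {ℕ.suc n} h = +-nonneg (h zero) (∑-nonneg (h ∘ suc))

  ∑≈0 : ∀ {n} {f : Vector Carrier n} → (∀ i → f i ≈ 0#) → ∑ f ≈ 0#
  ∑≈0 {ℕ.zero}  h = refl
  ∑≈0 {ℕ.suc n} h = +-cong (h zero) (∑≈0 (h ∘ suc)) ∙ +-identityˡ 0#

  term≤∑ : ∀ {n} {f : Vector Carrier n} → (∀ i → 0# ≤ f i) → ∀ i → f i ≤ ∑ f
  term≤∑ {f = f} h zero = ≤-witness _ (∑-nonneg (h ∘ suc))
    (solve 2 (λ a b → (a :+ b) :- a := b) refl (f zero) (∑ (f ∘ suc)))
  term≤∑ {f = f} h (suc i) = ≤-trans (term≤∑ (h ∘ suc) i)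
    (≤-witness _ (h zero) (solve 2 (λ a b → (a :+ b) :- b := a) refl (f zero) (∑ (f ∘ suc))))

  ν : ℕ → Carrier
  ν n = ∑ {n} λ _ → 1#

  ν-nonneg : ∀ n → 0# ≤ ν n
  ν-nonneg n = ∑-nonneg {n} λ _ → 0≤1#

  ∑-const : ∀ n x → ∑ {n} (λ _ → x) ≈ ν n * x
  ∑-const n x = sum-cong-≋ {n} (λ _ → sym (*-identityˡ x)) ∙ sym (*-distribʳ-sum {n} x (λ _ → 1#))

  infixr 5 _⊕_
  _⊕_ : ∀ {m n} → Vector Carrier m → Vector Carrier n → Vector Carrier (m ℕ.+ n)
  (u ⊕ v) i = [ u , v ]′ (splitAt _ i)

  ∑-⊕ : ∀ {m n} (u : Vector Carrier m) (v : Vector Carrier n) → ∑ (u ⊕ v) ≈ ∑ u + ∑ v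
  ∑-⊕ {ℕ.zero}  u v = sym (+-identityˡ (∑ v))
  ∑-⊕ {ℕ.suc m} u v =
    +-congˡ (sum-cong-≋ {_} {λ i → (u ⊕ v) (suc i)} {(u ∘ suc) ⊕ v} tail≈ ∙ ∑-⊕ (u ∘ suc) v)
    ∙ sym (+-assoc (u zero) (∑ (u ∘ suc)) (∑ v))
    where
    tail≈ : ∀ i → (u ⊕ v) (suc i) ≈ ((u ∘ suc) ⊕ v) i
    tail≈ i with splitAt m i
    ... | inj₁ _ = refl
    ... | inj₂ _ = refl

  -- The predicate sees index and value together, so the two blocks can be treated separately
  -- without unfolding `splitAt` at each use.
  ⊕-elim : ∀ {m n} (P : Fin (m ℕ.+ n) → Carrier → Set) {u : Vector Carrier m} {v : Vector Carrier n} →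
    (∀ i → P (i ↑ˡ n) (u i)) → (∀ i → P (m ↑ʳ i) (v i)) → ∀ i → P i ((u ⊕ v) i)
  ⊕-elim {m} {n} P hu hv i with splitAt m i | splitAt⁻¹-↑ˡ {m} {n} {i} | splitAt⁻¹-↑ʳ {m} {n} {i}
  ... | inj₁ j | eq | _ = ≡.subst (λ k → P k _) (eq ≡.refl) (hu j)
  ... | inj₂ j | _ | eq = ≡.subst (λ k → P k _) (eq ≡.refl) (hv j)

  -- Normalisation

  inv : Carrier → Carrier
  inv a = ρ a * ρ a

  inv-nonneg : ∀ a → 0# ≤ inv a
  inv-nonneg a = *-nonneg (ρ-nonneg a) (ρ-nonneg a)

  inverse-unique : ∀ {a b c} → b * a ≈ 1# → c * a ≈ 1# → b ≈ c
  inverse-unique {a} {b} {c} ba≈1 ca≈1 =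
    sym (*-identityˡ b) ∙ *-congʳ (sym ca≈1)
    ∙ solve 3 (λ a b c → c :* a :* b := c :* (b :* a)) refl a b c
    ∙ *-congˡ ba≈1 ∙ *-identityʳ c

  normalise : ∀ {n} → Vector Carrier n → Vector Carrier n
  normalise p v = p v * inv (∑ p)

  normalise-nonneg : ∀ {n} (p : Vector Carrier n) → (∀ v → 0# ≤ p v) → ∀ v → 0# ≤ normalise p v
  normalise-nonneg p 0≤p v = *-nonneg (0≤p v) (inv-nonneg (∑ p))

  ∑-normalise : ∀ {n} (p : Vector Carrier n) → 1# ≤ ∑ p → ∑ (normalise p) ≈ 1#
  ∑-normalise p 1≤∑p = sym (*-distribʳ-sum (inv (∑ p)) p) ∙ *-comm (∑ p) (inv (∑ p)) ∙ ρ²x≈1 1≤∑p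

  -- Both `inv (∑ p′) * c` and `inv (∑ p)` are inverses of `∑ p`, hence equal.
  normalise-scale : ∀ {n} (p p′ : Vector Carrier n) c → 1# ≤ ∑ p → 1# ≤ ∑ p′ →
    (∀ v → p′ v ≈ c * p v) → ∀ v → normalise p′ v ≈ normalise p v
  normalise-scale p p′ c 1≤∑p 1≤∑p′ p′≈cp v =
    *-congʳ (p′≈cp v)
    ∙ solve 3 (λ c p i → c :* p :* i := p :* (i :* c)) refl c (p v) (inv (∑ p′))
    ∙ *-congˡ (inverse-unique
        (*-assoc (inv (∑ p′)) c (∑ p)
         ∙ *-congˡ (*-distribˡ-sum c p ∙ sym (sum-cong-≋ p′≈cp))
         ∙ ρ²x≈1 1≤∑p′)
        (ρ²x≈1 1≤∑p))

  normalise-of-multiple : ∀ {n} (p x : Vector Carrier n) c → 1# ≤ ∑ p → ∑ x ≈ 1# →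
    (∀ v → p v ≈ c * x v) → ∀ v → normalise p v ≈ x v
  normalise-of-multiple p x c 1≤∑p ∑x≈1 p≈cx v =
    *-congʳ (p≈cx v)
    ∙ solve 3 (λ c x i → c :* x :* i := (i :* c) :* x) refl c (x v) (inv (∑ p))
    ∙ *-congʳ (*-congˡ (sym ∑p≈c) ∙ ρ²x≈1 1≤∑p)
    ∙ *-identityˡ (x v)
    where
    ∑p≈c : ∑ p ≈ c
    ∑p≈c = sum-cong-≋ p≈cx ∙ sym (*-distribˡ-sum c x) ∙ *-congˡ ∑x≈1 ∙ *-identityʳ c

  -- The retraction onto the cross-polytope

  twice-min : ∀ {n} → Vector Carrier n → Vector Carrier n → Vector Carrier n
  twice-min x y j = (x j + y j) - ∣ x j - y j ∣

  common : ∀ {n} → Vector Carrier n → Vector Carrier n → Carrier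
  common x y = ∑ (twice-min x y)

  path : ∀ {n} → Vector Carrier n → Vector Carrier n → Carrier → Vector Carrier n
  path x y t i = x i - (1# - t) * (y i + common x y)

  κ : ℕ → Carrier
  κ n = ((ν n + ν n) + ν n) + (1# + 1#)

  κ-nonneg : ∀ n → 0# ≤ κ n
  κ-nonneg n = +-nonneg (+-nonneg (+-nonneg (ν-nonneg n) (ν-nonneg n)) (ν-nonneg n)) (+-nonneg 0≤1# 0≤1#)

  -- The points of the complex as the estimates see them. The last field is what the lower bound
  -- takes from the face condition: with all x positive, every whisker completes a forbidden triple.
  record Admissible {n} (x y : Vector Carrier n) : Set where
    field
      x-nonneg : ∀ i → 0# ≤ x i
      y-nonneg : ∀ i → 0# ≤ y i
      total    : ∑ x + ∑ y ≈ 1#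
      x>0⇒y≤0  : (∀ i → ¬ (x i ≤ 0#)) → ∀ i → y i ≤ 0#

  module _ {n} {x y : Vector Carrier n} (adm : Admissible x y) where
    open Admissible adm

    private
      m = common x y
      Y = ∑ y
      part = twice-min x y

      part-nonneg : ∀ j → 0# ≤ part j
      part-nonneg j = x≤y⇒0≤y-x (∣x∣≤y
        (≤-witness _ (+-nonneg (y-nonneg j) (y-nonneg j))
          (solve 2 (λ x y → (x :+ y) :- (x :- y) := y :+ y) refl (x j) (y j)))
        (≤-witness _ (+-nonneg (x-nonneg j) (x-nonneg j))
          (solve 2 (λ x y → (x :+ y) :- (:- (x :- y)) := x :+ x) refl (x j) (y j))))

      part≤2y : ∀ j → part j ≤ y j + y j
      part≤2y j = ≤-witness _ (x≤y⇒0≤y-x (x≤∣x∣ (x j - y j)))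
        (solve 3 (λ x y a → (y :+ y) :- ((x :+ y) :- a) := a :- (x :- y)) refl (x j) (y j) ∣ x j - y j ∣)

    common-nonneg : 0# ≤ common x y
    common-nonneg = ∑-nonneg part-nonneg

    private
      m≤2Y : m ≤ Y + Y
      m≤2Y = ≤-trans (∑-mono-≤ part≤2y) (≤-reflexive (∑-distrib-+ y y))

      Y-nonneg : 0# ≤ Y
      Y-nonneg = ∑-nonneg y-nonneg

      y≤x⇒2y≤m : ∀ i → y i ≤ x i → y i + y i ≤ m
      y≤x⇒2y≤m i y≤x = ≤-trans (≤-reflexive (sym
        (+-congˡ (-‿cong (0≤x⇒∣x∣≈x (x≤y⇒0≤y-x y≤x)))
         ∙ solve 2 (λ x y → (x :+ y) :- (x :- y) := y :+ y) refl (x i) (y i))))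
        (term≤∑ part-nonneg i)

      x≤y⇒2x≤m : ∀ i → x i ≤ y i → x i + x i ≤ m
      x≤y⇒2x≤m i x≤y = ≤-trans (≤-reflexive (sym
        (+-congˡ (-‿cong (sym (abs-neg (x i - y i))
           ∙ abs-cong (solve 2 (λ x y → :- (x :- y) := y :- x) refl (x i) (y i))
           ∙ 0≤x⇒∣x∣≈x (x≤y⇒0≤y-x x≤y)))
         ∙ solve 2 (λ x y → (x :+ y) :- (y :- x) := x :+ x) refl (x i) (y i))))
        (term≤∑ part-nonneg i)

    module _ {t} (0≤t : 0# ≤ t) (t≤1 : t ≤ 1#) where
      private
        s = 1# - t
        W = path x y t
        S = ∑ λ i → ∣ W i ∣
        G = S + t * (Y + Y)

        0≤s : 0# ≤ s
        0≤s = x≤y⇒0≤y-x t≤1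

        S-nonneg : 0# ≤ S
        S-nonneg = ∑-nonneg λ i → abs-nonneg (W i)

        tY-nonneg : 0# ≤ t * Y
        tY-nonneg = *-nonneg 0≤t Y-nonneg

        G-nonneg : 0# ≤ G
        G-nonneg = +-nonneg S-nonneg (*-nonneg 0≤t (+-nonneg Y-nonneg Y-nonneg))

        ∣W∣≤S : ∀ i → ∣ W i ∣ ≤ S
        ∣W∣≤S = term≤∑ λ i → abs-nonneg (W i)

        S≤G : S ≤ G
        S≤G = ≤-witness _ (*-nonneg 0≤t (+-nonneg Y-nonneg Y-nonneg))
          (solve 2 (λ S r → (S :+ r) :- S := r) refl S (t * (Y + Y)))

        -- If some x j vanishes, then W j ≤ - s m, so |W j| alone reaches s m. If none does, all y
        -- vanish and m ≤ 2Y ≤ 0. Which case holds cannot be decided, but the goal is a stable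
        -- inequality.
        sm≤G : s * m ≤ G
        sm≤G = ≤-stable λ sm≰G → sm≰G (≤-trans
          (≤-witness _ (*-nonneg 0≤s (0≤-x (m≤0 λ j xj≤0 → sm≰G (if-vanishing j xj≤0))))
            (solve 2 (λ s m → con 0ℚ :- s :* m := s :* (:- m)) refl s m))
          G-nonneg)
          where
          if-vanishing : ∀ j → x j ≤ 0# → s * m ≤ G
          if-vanishing j xj≤0 = ≤-trans (≤-trans
            (≤-witness _
              (+-nonneg (+-nonneg (pos-nonneg (W j)) (0≤-x xj≤0)) (*-nonneg 0≤s (y-nonneg j)))
              (solve 5 (λ x s y m a → a :- s :* m :=
                 ((a :+ (x :- s :* (y :+ m))) :+ (:- x)) :+ s :* y) refl (x j) s (y j) m ∣ W j ∣))
            (∣W∣≤S j)) S≤G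
          m≤0 : (∀ j → ¬ (x j ≤ 0#)) → m ≤ 0#
          m≤0 x>0 = ≤-trans m≤2Y (≤-trans (+-mono-≤ Y≤0 Y≤0) (≤-reflexive (+-identityˡ 0#)))
            where
            Y≤0 : Y ≤ 0#
            Y≤0 = ≤-trans (∑-mono-≤ (x>0⇒y≤0 x>0)) (≤-reflexive (∑≈0 {n} λ _ → refl))

        -- If y ≤ x, then 2y ≤ m and the bound on s m applies. If x ≤ y, then 2x ≤ m, and s y = x -
        -- W - s m ≤ |W| + (m - s m) = |W| + t m, where m ≤ 2Y.
        sy≤G : ∀ i → s * y i ≤ G
        sy≤G i = ≤-cases (y i) (x i)
          (λ y≤x → ≤-witness _
            (+-nonneg (+-nonneg (x≤y⇒0≤y-x sm≤G) (*-nonneg 0≤s (x≤y⇒0≤y-x (y≤x⇒2y≤m i y≤x))))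
                      (*-nonneg 0≤s (y-nonneg i)))
            (solve 4 (λ G s y m → G :- s :* y :=
               ((G :- s :* m) :+ s :* (m :- (y :+ y))) :+ s :* y) refl G s (y i) m))
          (λ x≤y → ≤-witness _
            (+-nonneg (+-nonneg (+-nonneg (x≤y⇒0≤y-x (∣W∣≤S i)) (pos-nonneg (W i)))
                                (*-nonneg 0≤t (x≤y⇒0≤y-x m≤2Y)))
                      (+-nonneg (x≤y⇒0≤y-x (x≤y⇒2x≤m i x≤y)) (x-nonneg i)))
            (solve 7 (λ S t Y x y m a → (S :+ t :* (Y :+ Y)) :- (con 1ℚ :- t) :* y :=
               (((S :- a) :+ (a :+ (x :- (con 1ℚ :- t) :* (y :+ m)))) :+ t :* ((Y :+ Y) :- m))
                 :+ ((m :- (x :+ x)) :+ x))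
               refl S t Y (x i) (y i) m ∣ W i ∣))

        sY≤νG : s * Y ≤ ν n * G
        sY≤νG = ≤-trans (≤-reflexive (*-distribˡ-sum s y))
          (≤-trans (∑-mono-≤ sy≤G) (≤-reflexive (∑-const n G)))

        -- Each x i equals W i + s y i + s m, and the last two terms are at most G each.
        X≤S+ν2G : ∑ x ≤ S + ν n * (G + G)
        X≤S+ν2G = ≤-trans (∑-mono-≤ term)
          (≤-reflexive (∑-distrib-+ (λ i → ∣ W i ∣) (λ _ → G + G) ∙ +-congˡ (∑-const n (G + G))))
          where
          term : ∀ i → x i ≤ ∣ W i ∣ + (G + G)
          term i = ≤-witness _
            (+-nonneg (+-nonneg (neg-nonneg (W i)) (x≤y⇒0≤y-x (sy≤G i))) (x≤y⇒0≤y-x sm≤G))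
            (solve 6 (λ G s x y m a → (a :+ (G :+ G)) :- x :=
               ((a :- (x :- s :* (y :+ m))) :+ (G :- s :* y)) :+ (G :- s :* m))
               refl G s (x i) (y i) m ∣ W i ∣)

        -- Splitting Y as s Y + t Y gives 1 = X + Y ≤ (S + 2nG) + nG + t Y, and S + t Y ≤ 2G. This
        -- is the origin of the constant 3n + 2.
        1≤κG : 1# ≤ κ n * G
        1≤κG = ≤-trans (≤-reflexive (sym total)) (≤-witness _
          (+-nonneg (+-nonneg (x≤y⇒0≤y-x X≤S+ν2G) (x≤y⇒0≤y-x sY≤νG))
                    (+-nonneg (x≤y⇒0≤y-x S≤G) (+-nonneg S-nonneg tY-nonneg)))
          (solve 5 (λ ν S t X Y →
             let G = S :+ t :* (Y :+ Y) in
             (((ν :+ ν) :+ ν) :+ (con 1ℚ :+ con 1ℚ)) :* G :- (X :+ Y) :=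
             (((S :+ ν :* (G :+ G)) :- X) :+ (ν :* G :- (con 1ℚ :- t) :* Y))
               :+ ((G :- S) :+ (S :+ t :* Y)))
             refl (ν n) S t (∑ x) Y))

      path-bound : 1# ≤ κ n * ∑ λ i → ∣ path x y t i ∣ + t * (y i + y i)
      path-bound = ≤-trans 1≤κG (≤-reflexive (*-congˡ (sym
        (∑-distrib-+ (λ i → ∣ W i ∣) (λ i → t * (y i + y i))
         ∙ +-congˡ (sym (*-distribˡ-sum t (λ i → y i + y i)) ∙ *-congˡ (∑-distrib-+ y y))))))

  left right : ∀ n → Vector Carrier (n ℕ.+ n) → Vector Carrier n
  left  n p i = p (i ↑ˡ n)
  right n p i = p (n ↑ʳ i)

  ⊕-left : ∀ {n} (u v : Vector Carrier n) i → left n (u ⊕ v) i ≡.≡ u i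
  ⊕-left {n} u v i = ≡.cong [ u , v ]′ (splitAt-↑ˡ n i n)

  ⊕-right : ∀ {n} (u v : Vector Carrier n) i → right n (u ⊕ v) i ≡.≡ v i
  ⊕-right {n} u v i = ≡.cong [ u , v ]′ (splitAt-↑ʳ n n i)

  ∑-left+∑-right : ∀ n (p : Vector Carrier (n ℕ.+ n)) → ∑ (left n p) + ∑ (right n p) ≈ ∑ p
  ∑-left+∑-right n p = sym (∑-⊕ (left n p) (right n p))
    ∙ sum-cong-≋ (⊕-elim {n} {n} (λ k r → r ≈ p k) {left n p} {right n p} (λ _ → refl) (λ _ → refl))

  ∑-left+∑-right≈1 : ∀ n (p : Vector Carrier (n ℕ.+ n)) → ∑ p ≈ 1# → ∑ (left n p) + ∑ (right n p) ≈ 1#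
  ∑-left+∑-right≈1 n p ∑p≈1 = ∑-left+∑-right n p ∙ ∑p≈1

  1≤ν : ∀ {n} → Fin n → 1# ≤ ν n
  1≤ν i = term≤∑ (λ _ → 0≤1#) i

  x≰0⇒0≤x : ∀ {x} → ¬ (x ≤ 0#) → 0# ≤ x
  x≰0⇒0≤x {x} x≰0 = ≤-cases 0# x id (λ x≤0 → ⊥-elim (x≰0 x≤0))

  -- The map to the sphere

  -- The factor `κ n` raises the sum of absolute values to at least 1, and `ν n` compensates for the
  -- passage from that sum to the sum of squares. The sum of squares then lies where `ρ` is the
  -- exact inverse square root.
  scaled-path : ∀ {n} → Vector Carrier n → Vector Carrier n → Vector Carrier n
  scaled-path {n} x y i = (ν n * κ n) * path x y 0# i

  square-norm : ∀ {n} → Vector Carrier n → Carrier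
  square-norm z = ∑ λ i → z i * z i

  toSphere : ∀ {n} → Vector Carrier n → Vector Carrier n → Vector Carrier n
  toSphere x y i = scaled-path x y i * ρ (square-norm (scaled-path x y))

  square-norm-scale : ∀ {n} (z : Vector Carrier n) a →
    square-norm (λ i → z i * a) ≈ (a * a) * square-norm z
  square-norm-scale z a =
    sum-cong-≋ (λ i → solve 2 (λ z a → z :* a :* (z :* a) := a :* a :* (z :* z)) refl (z i) a)
    ∙ sym (*-distribˡ-sum (a * a) (λ i → z i * z i))

  -- With b i = κ |W i| and Σ b ≥ 1, the inequality (n b i - 1)² ≥ 0 gives (n b i)² ≥ 2n b i - 1.
  -- Summing over i yields at least 2n - n = n ≥ 1. The index `i₀` supplies n ≥ 1.
  1≤square-norm : ∀ {n} {x y : Vector Carrier n} → Admissible x y → Fin n →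
    1# ≤ square-norm (scaled-path x y)
  1≤square-norm {n} {x} {y} adm i₀ = ≤-trans
    (≤-witness _
      (+-nonneg (*-nonneg (+-nonneg (ν-nonneg n) (ν-nonneg n)) (x≤y⇒0≤y-x 1≤B)) (x≤y⇒0≤y-x (1≤ν i₀)))
      (solve 2 (λ v B → ((v :+ v) :* B :+ v :* (:- con 1ℚ)) :- con 1ℚ :=
         (v :+ v) :* (B :- con 1ℚ) :+ (v :- con 1ℚ)) refl (ν n) B))
    (≤-trans (≤-reflexive (sym
        (∑-distrib-+ (λ i → (ν n + ν n) * b i) (λ _ → - 1#)
         ∙ +-cong (sym (*-distribˡ-sum (ν n + ν n) b)) (∑-const n (- 1#)))))
      (∑-mono-≤ term))
    where
    W = path x y 0#
    b : Vector Carrier n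
    b i = κ n * ∣ W i ∣
    B = ∑ b
    1≤B : 1# ≤ B
    1≤B = ≤-trans (path-bound adm ≤-refl 0≤1#) (≤-reflexive
      (*-congˡ (sum-cong-≋ λ i → solve 2 (λ a y → a :+ con 0ℚ :* y := a) refl ∣ W i ∣ (y i + y i))
       ∙ *-distribˡ-sum (κ n) (λ i → ∣ W i ∣)))
    term : ∀ i → (ν n + ν n) * b i + - 1# ≤ scaled-path x y i * scaled-path x y i
    term i = ≤-trans
      (≤-witness _ (square-nonneg (ν n * b i - 1#))
        (solve 2 (λ v b → (v :* b) :* (v :* b) :- ((v :+ v) :* b :+ (:- con 1ℚ)) :=
           (v :* b :- con 1ℚ) :* (v :* b :- con 1ℚ)) refl (ν n) (b i)))
      (≤-reflexive
        (solve 3 (λ v k a → (v :* (k :* a)) :* (v :* (k :* a)) := ((v :* k) :* (v :* k)) :* (a :* a))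
           refl (ν n) (κ n) ∣ W i ∣
         ∙ *-congˡ (abs-square (W i))
         ∙ solve 2 (λ v w → (v :* v) :* (w :* w) := (v :* w) :* (v :* w)) refl (ν n * κ n) (W i)))

  toSphere-unit : ∀ {n} {x y : Vector Carrier n} → Admissible x y → Fin n →
    square-norm (toSphere x y) ≈ 1#
  toSphere-unit {x = x} {y} adm i₀ =
    square-norm-scale (scaled-path x y) (ρ (square-norm (scaled-path x y)))
    ∙ ρ²x≈1 (1≤square-norm adm i₀)

  -- The map from the sphere

  signed : ∀ {n} → Vector Carrier n → Vector Carrier (n ℕ.+ n)
  signed z = (λ i → pos (z i)) ⊕ (λ i → neg (z i))

  signed-nonneg : ∀ {n} (z : Vector Carrier n) v → 0# ≤ signed z v
  signed-nonneg z = ⊕-elim (λ _ r → 0# ≤ r) (λ i → pos-nonneg (z i)) (λ i → neg-nonneg (z i))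

  -- The sum is 2S with S = Σ |z i|, and S² ≥ Σ z i² = 1 because |z i|² ≤ |z i| S for each i.
  1≤∑-signed : ∀ {n} (z : Vector Carrier n) → square-norm z ≈ 1# → 1# ≤ ∑ (signed z)
  1≤∑-signed z z²≈1 = ≤-trans
    (≤-trans 1≤S (≤-witness S S-nonneg (solve 1 (λ S → (S :+ S) :- S := S) refl S)))
    (≤-reflexive (sym
      (∑-⊕ (λ i → pos (z i)) (λ i → neg (z i))
       ∙ sym (∑-distrib-+ (λ i → pos (z i)) (λ i → neg (z i)))
       ∙ sum-cong-≋ (λ i → solve 2 (λ a z → (a :+ z) :+ (a :- z) := a :+ a) refl ∣ z i ∣ (z i))
       ∙ ∑-distrib-+ (λ i → ∣ z i ∣) (λ i → ∣ z i ∣))))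
    where
    S = ∑ λ i → ∣ z i ∣
    S-nonneg : 0# ≤ S
    S-nonneg = ∑-nonneg λ i → abs-nonneg (z i)
    1≤S : 1# ≤ S
    1≤S = 1≤u²⇒1≤u S-nonneg (≤-trans (≤-reflexive (sym z²≈1)) (≤-trans
      (∑-mono-≤ λ i → ≤-trans (≤-reflexive (sym (abs-square (z i))))
        (*-monoʳ-≤ ∣ z i ∣ (abs-nonneg (z i)) (term≤∑ (λ j → abs-nonneg (z j)) i)))
      (≤-reflexive (sym (*-distribʳ-sum S (λ i → ∣ z i ∣))))))

  x≈0⇒xc≤0 : ∀ {x} c → x ≈ 0# → x * c ≤ 0#
  x≈0⇒xc≤0 c x≈0 = ≤-reflexive (*-congʳ x≈0 ∙ zeroˡ c)

  left-normalise-≰0 : ∀ {n} (u v : Vector Carrier n) i →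
    ¬ (left n (normalise (u ⊕ v)) i ≤ 0#) → ¬ (u i ≈ 0#)
  left-normalise-≰0 u v i ≰0 u≈0 = ≰0 (x≈0⇒xc≤0 (inv (∑ (u ⊕ v))) (reflexive (⊕-left u v i) ∙ u≈0))

  right-normalise-≤0 : ∀ {n} (u v : Vector Carrier n) i →
    v i ≈ 0# → right n (normalise (u ⊕ v)) i ≤ 0#
  right-normalise-≤0 u v i v≈0 = x≈0⇒xc≤0 (inv (∑ (u ⊕ v))) (reflexive (⊕-right u v i) ∙ v≈0)

  -- A nonzero positive part forces z i ≥ 0, and then the negative part vanishes.
  signed-support : ∀ {n} (z : Vector Carrier n) i →
    ¬ (left n (normalise (signed z)) i ≤ 0#) → right n (normalise (signed z)) i ≤ 0#
  signed-support z i ≰0 = right-normalise-≤0 _ _ i (0≤z⇒neg≈0 (x≰0⇒0≤x λ z≤0 →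
    left-normalise-≰0 (λ i → pos (z i)) (λ i → neg (z i)) i ≰0 (z≤0⇒pos≈0 z≤0)))

  -- The homotopy on the complex

  deformed : ∀ {n} → Vector Carrier n → Vector Carrier n → Carrier → Vector Carrier (n ℕ.+ n)
  deformed {n} x y t =
    (λ i → κ n * pos (path x y t i)) ⊕ (λ i → κ n * (neg (path x y t i) + t * (y i + y i)))

  module _ {n} {x y : Vector Carrier n} (adm : Admissible x y) where
    open Admissible adm

    path-≤0 : ∀ {t} → t ≤ 1# → ∀ i → x i ≤ 0# → path x y t i ≤ 0#
    path-≤0 {t} t≤1 i x≤0 = ≤-witness _
      (+-nonneg (0≤-x x≤0) (*-nonneg (x≤y⇒0≤y-x t≤1) (+-nonneg (y-nonneg i) (common-nonneg adm))))
      (solve 3 (λ x s r → con 0ℚ :- (x :- s :* r) := (:- x) :+ s :* r) refl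
        (x i) (1# - t) (y i + common x y))

    deformed-nonneg : ∀ {t} → 0# ≤ t → ∀ v → 0# ≤ deformed x y t v
    deformed-nonneg {t} 0≤t = ⊕-elim (λ _ r → 0# ≤ r)
      (λ i → *-nonneg (κ-nonneg n) (pos-nonneg (path x y t i)))
      (λ i → *-nonneg (κ-nonneg n) (+-nonneg (neg-nonneg (path x y t i))
               (*-nonneg 0≤t (+-nonneg (y-nonneg i) (y-nonneg i)))))

    1≤∑-deformed : ∀ {t} → 0# ≤ t → t ≤ 1# → 1# ≤ ∑ (deformed x y t)
    1≤∑-deformed {t} 0≤t t≤1 = ≤-trans (path-bound adm 0≤t t≤1) (≤-trans
      (≤-reflexive (*-distribˡ-sum (κ n) (λ i → ∣ W i ∣ + t * (y i + y i))))
      (≤-trans (∑-mono-≤ term) (≤-reflexive (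
        ∑-distrib-+ (λ i → κ n * pos (W i)) (λ i → κ n * (neg (W i) + t * (y i + y i)))
        ∙ sym (∑-⊕ (λ i → κ n * pos (W i)) (λ i → κ n * (neg (W i) + t * (y i + y i))))))))
      where
      W = path x y t
      term : ∀ i → κ n * (∣ W i ∣ + t * (y i + y i)) ≤
                   κ n * pos (W i) + κ n * (neg (W i) + t * (y i + y i))
      term i = ≤-witness _ (*-nonneg (κ-nonneg n) (abs-nonneg (W i)))
        (solve 4 (λ k a w r → (k :* (a :+ w) :+ k :* ((a :- w) :+ r)) :- k :* (a :+ r) := k :* a)
           refl (κ n) ∣ W i ∣ (W i) (t * (y i + y i)))

    deformed-left-support : ∀ {t} → t ≤ 1# → ∀ i →
      ¬ (left n (normalise (deformed x y t)) i ≤ 0#) → ¬ (x i ≤ 0#)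
    deformed-left-support t≤1 i ≰0 x≤0 = left-normalise-≰0 _ _ i ≰0
      (*-congˡ (z≤0⇒pos≈0 (path-≤0 t≤1 i x≤0)) ∙ zeroʳ (κ n))

    -- A nonzero edge coordinate forces W i ≥ 0, so the negative part of W i disappears; y i = 0
    -- removes the remaining summand.
    deformed-right-support : ∀ t i → ¬ (left n (normalise (deformed x y t)) i ≤ 0#) →
      y i ≤ 0# → right n (normalise (deformed x y t)) i ≤ 0#
    deformed-right-support t i ≰0 y≤0 = right-normalise-≤0 _ _ i
      (*-congˡ (+-cong (0≤z⇒neg≈0 0≤W) (*-congˡ (+-cong y≈0 y≈0)))
       ∙ solve 2 (λ k t → k :* (con 0ℚ :+ t :* (con 0ℚ :+ con 0ℚ)) := con 0ℚ) refl (κ n) t)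
      where
      y≈0 : y i ≈ 0#
      y≈0 = ≤-antisym y≤0 (y-nonneg i)
      0≤W : 0# ≤ path x y t i
      0≤W = x≰0⇒0≤x λ W≤0 → left-normalise-≰0 _ _ i ≰0
        (*-congˡ (z≤0⇒pos≈0 W≤0) ∙ zeroʳ (κ n))

    -- Both vectors are nonnegative multiples of the signed parts of W at t = 0, and normalising
    -- forgets the factor. As `deformed` already contains `κ n`, the ratio is `ν n * r`.
    deformed-start : Fin n → ∀ v →
      normalise (deformed x y 0#) v ≈ normalise (signed (toSphere x y)) v
    deformed-start i₀ v = sym (normalise-scale (deformed x y 0#) (signed (toSphere x y)) (ν n * r)
      (1≤∑-deformed ≤-refl 0≤1#) (1≤∑-signed (toSphere x y) (toSphere-unit adm i₀)) multiple v)
      where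
      r = ρ (square-norm (scaled-path x y))
      a = (ν n * κ n) * r
      0≤a : 0# ≤ a
      0≤a = *-nonneg (*-nonneg (ν-nonneg n) (κ-nonneg n)) (ρ-nonneg _)
      W = path x y 0#
      q≈aW : ∀ i → toSphere x y i ≈ a * W i
      q≈aW i = solve 3 (λ c w r → c :* w :* r := c :* r :* w) refl (ν n * κ n) (W i) r
      multiple : ∀ v → signed (toSphere x y) v ≈ (ν n * r) * deformed x y 0# v
      multiple v with splitAt n v
      ... | inj₁ i = pos-cong (q≈aW i) ∙ pos-scale (W i) 0≤a
        ∙ solve 4 (λ v k r p → (v :* k :* r) :* p := (v :* r) :* (k :* p)) refl (ν n) (κ n) r (pos (W i))
      ... | inj₂ i = neg-cong (q≈aW i) ∙ neg-scale (W i) 0≤a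
        ∙ solve 5 (λ v k r p y → (v :* k :* r) :* p := (v :* r) :* (k :* (p :+ con 0ℚ :* y)))
            refl (ν n) (κ n) r (neg (W i)) (y i + y i)

    -- Since pos z + neg z = 2|z| and pos z - neg z = 2z, all minima vanish and the path at t = 0 is
    -- 2c z. The image is thus a nonnegative multiple of the unit vector z, rescaled to length 1.
    toSphere-signed : ∀ z c → 0# ≤ c → square-norm z ≈ 1# → Fin n →
      (∀ i → x i ≈ pos (z i) * c) → (∀ i → y i ≈ neg (z i) * c) → ∀ i → toSphere x y i ≈ z i
    toSphere-signed z c 0≤c z²≈1 i₀ x≈ y≈ i =
      *-congʳ (g≈ze i) ∙ *-assoc (z i) e r ∙ *-congˡ u≈1 ∙ *-identityʳ (z i)
      where
      e = (ν n * κ n) * (c + c)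
      0≤c+c = +-nonneg 0≤c 0≤c
      r = ρ (square-norm (scaled-path x y))
      common≈0 : common x y ≈ 0#
      common≈0 = ∑≈0 λ j →
        +-cong (+-cong (x≈ j) (y≈ j)) (-‿cong (abs-cong (+-cong (x≈ j) (-‿cong (y≈ j)))
          ∙ abs-cong (solve 3 (λ a z c → (a :+ z) :* c :- (a :- z) :* c := (c :+ c) :* z) refl ∣ z j ∣ (z j) c)
          ∙ abs-scale (z j) 0≤c+c))
        ∙ solve 3 (λ a z c → ((a :+ z) :* c :+ (a :- z) :* c) :- (c :+ c) :* a := con 0ℚ) refl ∣ z j ∣ (z j) c
      g≈ze : ∀ i → scaled-path x y i ≈ z i * e
      g≈ze i = *-congˡ (+-cong (x≈ i) (-‿cong (*-congˡ (+-cong (y≈ i) common≈0))))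
        ∙ solve 4 (λ k a z c → k :* ((a :+ z) :* c :- (con 1ℚ :- con 0ℚ) :* ((a :- z) :* c :+ con 0ℚ))
            := z :* (k :* (c :+ c))) refl (ν n * κ n) ∣ z i ∣ (z i) c
      square-norm≈e² : square-norm (scaled-path x y) ≈ e * e
      square-norm≈e² = sum-cong-≋ (λ i → *-cong (g≈ze i) (g≈ze i))
        ∙ square-norm-scale z e ∙ *-congˡ z²≈1 ∙ *-identityʳ (e * e)
      u≈1 : e * r ≈ 1#
      -- The square of `e * r` is 1 by the property of `ρ`; nonnegativity of `e` and `r` selects the
      -- root 1 rather than -1.
      u≈1 = u²≈1⇒u≈1
        (*-nonneg (*-nonneg (*-nonneg (ν-nonneg n) (κ-nonneg n)) 0≤c+c) (ρ-nonneg _))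
        (solve 2 (λ e r → e :* r :* (e :* r) := (r :* r) :* (e :* e)) refl e r
         ∙ *-congˡ (sym square-norm≈e²) ∙ ρ²x≈1 (1≤square-norm adm i₀))

  toSphere∘signed : ∀ {n} (z : Vector Carrier n) → square-norm z ≈ 1# → Fin n →
    Admissible (left n (normalise (signed z))) (right n (normalise (signed z))) →
    ∀ i → toSphere (left n (normalise (signed z))) (right n (normalise (signed z))) i ≈ z i
  toSphere∘signed {n} z z²≈1 i₀ adm = toSphere-signed adm z (inv (∑ (signed z))) (inv-nonneg _) z²≈1 i₀
    (λ i → *-congʳ (reflexive (⊕-left _ _ i))) (λ i → *-congʳ (reflexive (⊕-right _ _ i)))

  deformed-end : ∀ {n} (p : Vector Carrier (n ℕ.+ n)) → Admissible (left n p) (right n p) →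
    ∀ v → normalise (deformed (left n p) (right n p) 1#) v ≈ p v
  deformed-end {n} p adm = normalise-of-multiple (deformed (left n p) (right n p) 1#) p (κ n * (1# + 1#))
    (1≤∑-deformed adm 0≤1# ≤-refl) (sym (∑-left+∑-right n p) ∙ total)
    (⊕-elim {n} {n} (λ k r → r ≈ κ n * (1# + 1#) * p k)
      (λ i → *-congˡ (pos-cong (W≈x i) ∙ +-congʳ (0≤x⇒∣x∣≈x (x-nonneg i)))
        ∙ solve 2 (λ k x → k :* (x :+ x) := k :* (con 1ℚ :+ con 1ℚ) :* x) refl (κ n) (left n p i))
      (λ i → *-congˡ (+-congʳ (neg-cong (W≈x i) ∙ 0≤z⇒neg≈0 (x-nonneg i)))
        ∙ solve 2 (λ k y → k :* (con 0ℚ :+ con 1ℚ :* (y :+ y)) := k :* (con 1ℚ :+ con 1ℚ) :* y) refl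
            (κ n) (right n p i)))
    where
    open Admissible adm
    W≈x : ∀ i → path (left n p) (right n p) 1# i ≈ left n p i
    W≈x i = solve 2 (λ x r → x :- (con 1ℚ :- con 1ℚ) :* r := x) refl
      (left n p i) (right n p i + common (left n p) (right n p))

-- The 2-matchings of a whiskered cycle.

module WhiskeredCycles where

  open import Data.Bool.Base using (true; false)
  open import Data.Fin.Base using (toℕ; fromℕ; inject₁)
  open import Data.Fin.Properties
    using (_≟_; toℕ-injective; toℕ-fromℕ<; toℕ-fromℕ; toℕ-inject₁; toℕ<n; ↑ˡ-injective)
  open import Data.Fin.Subset using (Subset; ⁅_⁆; _∈_; _∪_; _-_; ∣_∣)
  open import Data.Fin.Subset.Properties
    using (_∈?_; x∈⁅x⁆; x∈p∩q⁺; x∈p∩q⁻; x∈p∪q⁺; p⊆q⇒∣p∣≤∣q∣; ∣⁅x⁆∣≡1;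
           x∈p⇒∣p-x∣<∣p∣; x∈p∧x≢y⇒x∈p-y)
  open import Data.Nat.Base using (NonZero; s≤s; z≤n)
  open import Data.Nat.DivMod using (_%_; m%n<n; m<n⇒m%n≡m; n%n≡0)
  open import Data.Vec.Base using ([]; _∷_)
  open import Data.Vec.Properties using (lookup∘tabulate; lookup⇒[]=; []=⇒lookup)
  open import Relation.Binary.PropositionalEquality using (refl; sym; trans; cong; cong₂; subst)
  open import Relation.Nullary.Decidable using (_⊎-dec_; dec-true)
  open import Defs using (Graph; next; cycle; whiskered)

  -- The cyclic successor

  toℕ-next : ∀ {n} .{{_ : NonZero n}} (i : Fin n) → toℕ (next i) ≡ suc (toℕ i) % n
  toℕ-next {n} i = toℕ-fromℕ< (m%n<n (suc (toℕ i)) n)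

  toℕ-next-cases : ∀ {n} .{{_ : NonZero n}} (i : Fin n) →
    toℕ (next i) ≡ suc (toℕ i) ⊎ (toℕ (next i) ≡ 0 × suc (toℕ i) ≡ n)
  toℕ-next-cases {n} i with ℕ.m≤n⇒m<n∨m≡n (toℕ<n i)
  ... | inj₁ lt = inj₁ (trans (toℕ-next i) (m<n⇒m%n≡m lt))
  ... | inj₂ eq = inj₂ (trans (toℕ-next i) (trans (cong (_% n) eq) (n%n≡0 n)) , eq)

  next-injective : ∀ {n} .{{_ : NonZero n}} {i j : Fin n} → next i ≡ next j → i ≡ j
  next-injective {i = i} {j} eq with toℕ-next-cases i | toℕ-next-cases j
  ... | inj₁ a       | inj₁ b       = toℕ-injective (ℕ.suc-injective (trans (sym a) (trans (cong toℕ eq) b)))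
  ... | inj₂ (_ , a) | inj₂ (_ , b) = toℕ-injective (ℕ.suc-injective (trans a (sym b)))
  ... | inj₁ a       | inj₂ (b , _) = ⊥-elim (ℕ.1+n≢0 (trans (sym a) (trans (cong toℕ eq) b)))
  ... | inj₂ (a , _) | inj₁ b       = ⊥-elim (ℕ.1+n≢0 (trans (sym b) (trans (sym (cong toℕ eq)) a)))

  prev : ∀ {n} → Fin n → Fin n
  prev {suc m} zero    = fromℕ m
  prev {suc m} (suc i) = inject₁ i

  next-prev : ∀ {n} .{{_ : NonZero n}} (i : Fin n) → next (prev i) ≡ i
  next-prev {suc m} zero = toℕ-injective (trans (toℕ-next (fromℕ m))
    (trans (cong (λ k → suc k % suc m) (toℕ-fromℕ m)) (n%n≡0 (suc m))))
  next-prev {suc m} (suc i) = toℕ-injective (trans (toℕ-next (inject₁ i))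
    (trans (cong (λ k → suc k % suc m) (toℕ-inject₁ i)) (m<n⇒m%n≡m (s≤s (toℕ<n i)))))

  -- Sets of edges

  ∣p∪q∣≤∣p∣+∣q∣ : ∀ {n} (p q : Subset n) → ∣ p ∪ q ∣ ℕ.≤ ∣ p ∣ ℕ.+ ∣ q ∣
  ∣p∪q∣≤∣p∣+∣q∣ []          []          = z≤n
  ∣p∪q∣≤∣p∣+∣q∣ (false ∷ p) (false ∷ q) = ∣p∪q∣≤∣p∣+∣q∣ p q
  ∣p∪q∣≤∣p∣+∣q∣ (false ∷ p) (true  ∷ q) =
    ℕ.≤-trans (s≤s (∣p∪q∣≤∣p∣+∣q∣ p q)) (ℕ.≤-reflexive (sym (ℕ.+-suc ∣ p ∣ ∣ q ∣)))
  ∣p∪q∣≤∣p∣+∣q∣ (true  ∷ p) (false ∷ q) = s≤s (∣p∪q∣≤∣p∣+∣q∣ p q)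
  ∣p∪q∣≤∣p∣+∣q∣ (true  ∷ p) (true  ∷ q) =
    s≤s (ℕ.≤-trans (∣p∪q∣≤∣p∣+∣q∣ p q) (ℕ.+-monoʳ-≤ ∣ p ∣ (ℕ.n≤1+n ∣ q ∣)))

  p⊆ab⇒∣p∣≤2 : ∀ {n} {p : Subset n} a b → (∀ {e} → e ∈ p → e ≡ a ⊎ e ≡ b) → ∣ p ∣ ℕ.≤ 2
  p⊆ab⇒∣p∣≤2 {p = p} a b h = ℕ.≤-trans
    (p⊆q⇒∣p∣≤∣q∣ {p = p} {q = ⁅ a ⁆ ∪ ⁅ b ⁆} λ e∈p → x∈p∪q⁺
      ([ (λ e≡a → inj₁ (subst (_∈ ⁅ a ⁆) (sym e≡a) (x∈⁅x⁆ a)))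
       , (λ e≡b → inj₂ (subst (_∈ ⁅ b ⁆) (sym e≡b) (x∈⁅x⁆ b))) ]′ (h e∈p)))
    (ℕ.≤-trans (∣p∪q∣≤∣p∣+∣q∣ ⁅ a ⁆ ⁅ b ⁆)
      (ℕ.≤-reflexive (cong₂ ℕ._+_ (∣⁅x⁆∣≡1 a) (∣⁅x⁆∣≡1 b))))

  abc∈p⇒3≤∣p∣ : ∀ {n} {p : Subset n} {a b c} → a ≢ b → a ≢ c → b ≢ c →
    a ∈ p → b ∈ p → c ∈ p → 3 ℕ.≤ ∣ p ∣
  abc∈p⇒3≤∣p∣ {p = p} {a} {b} {c} a≢b a≢c b≢c a∈p b∈p c∈p =
    ℕ.≤-trans (s≤s (ℕ.≤-trans (s≤s (ℕ.≤-trans (s≤s z≤n) (x∈p⇒∣p-x∣<∣p∣ a∈p-c-b))) (x∈p⇒∣p-x∣<∣p∣ b∈p-c)))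
      (x∈p⇒∣p-x∣<∣p∣ c∈p)
    where
    b∈p-c : b ∈ p - c
    b∈p-c = x∈p∧x≢y⇒x∈p-y b∈p b≢c
    a∈p-c-b : a ∈ (p - c) - b
    a∈p-c-b = x∈p∧x≢y⇒x∈p-y (x∈p∧x≢y⇒x∈p-y a∈p a≢c) a≢b

  module _ (G : Graph) where
    open Graph G

    ∈-incident⁺ : ∀ {e v} → end₁ e ≡ v ⊎ end₂ e ≡ v → e ∈ incident v
    ∈-incident⁺ {e} {v} h = lookup⇒[]= e _ (trans (lookup∘tabulate _ e)
      (dec-true ((end₁ e ≟ v) ⊎-dec (end₂ e ≟ v)) h))

    ∈-incident⁻ : ∀ {e v} → e ∈ incident v → end₁ e ≡ v ⊎ end₂ e ≡ v
    ∈-incident⁻ {e} {v} e∈ = witness ((end₁ e ≟ v) ⊎-dec (end₂ e ≟ v))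
      (trans (sym (lookup∘tabulate _ e)) ([]=⇒lookup e∈))
      where
      witness : ∀ {P : Set} (d : Dec P) → does d ≡ true → P
      witness (yes p) _ = p

  module WhiskeredCycle (n : ℕ) (3≤n : 3 ℕ.≤ n) where

    C : Graph
    C = cycle n 3≤n

    G : Graph
    G = whiskered C

    open Graph G

    succ : Fin n → Fin n
    succ = Graph.end₂ C

    private instance
      n-nonZero : NonZero n
      n-nonZero = ℕ.>-nonZero (ℕ.≤-trans (s≤s z≤n) 3≤n)

    edge whisker : Fin n → Fin (n ℕ.+ n)
    edge    i = i ↑ˡ n
    whisker i = n ↑ʳ i

    edge≢whisker : ∀ {i j} → edge i ≢ whisker j
    edge≢whisker {i} {j} eq with trans (sym (splitAt-↑ˡ n i n)) (trans (cong (splitAt n) eq) (splitAt-↑ʳ n n j))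
    ... | ()

    end₁-edge : ∀ i → end₁ (edge i) ≡ i ↑ˡ n
    end₁-edge i rewrite splitAt-↑ˡ n i n = refl

    end₂-edge : ∀ i → end₂ (edge i) ≡ succ i ↑ˡ n
    end₂-edge i rewrite splitAt-↑ˡ n i n = refl

    end₁-whisker : ∀ i → end₁ (whisker i) ≡ i ↑ˡ n
    end₁-whisker i rewrite splitAt-↑ʳ n n i = refl

    end₂-whisker : ∀ i → end₂ (whisker i) ≡ n ↑ʳ i
    end₂-whisker i rewrite splitAt-↑ʳ n n i = refl

    -- These are all the edges at the cycle vertex `succ j`.
    HasTriple : Subset (n ℕ.+ n) → Set
    HasTriple σ = ∃ λ j → edge j ∈ σ × edge (succ j) ∈ σ × whisker (succ j) ∈ σ

    triple⇒¬2-matching : ∀ {σ} → HasTriple σ → ¬ Is2Matching σ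
    triple⇒¬2-matching {σ} (j , e∈ , f∈ , w∈) matching =
      ℕ.<⇒≱ (abc∈p⇒3≤∣p∣ (Graph.loopless C j ∘ ↑ˡ-injective n j (succ j)) edge≢whisker edge≢whisker
        (x∈p∩q⁺ (e∈ , ∈-incident⁺ G (inj₂ (end₂-edge j))))
        (x∈p∩q⁺ (f∈ , ∈-incident⁺ G (inj₁ (end₁-edge (succ j)))))
        (x∈p∩q⁺ (w∈ , ∈-incident⁺ G (inj₁ (end₁-whisker (succ j))))))
        (matching (succ j ↑ˡ n))

    data Edge : Fin (n ℕ.+ n) → Set where
      isEdge    : ∀ i → Edge (edge i)
      isWhisker : ∀ i → Edge (whisker i)

    edge-cases : ∀ e → Edge e
    edge-cases e with splitAt n e | splitAt⁻¹-↑ˡ {n} {n} {e} | splitAt⁻¹-↑ʳ {n} {n} {e}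
    ... | inj₁ i | eq | _ = subst Edge (eq refl) (isEdge i)
    ... | inj₂ i | _ | eq = subst Edge (eq refl) (isWhisker i)

    incident-leaf : ∀ {i e} → e ∈ incident (n ↑ʳ i) → e ≡ whisker i
    incident-leaf {i} {e} e∈ with edge-cases e | ∈-incident⁻ G {e} e∈
    ... | isEdge j    | inj₁ p = ⊥-elim (edge≢whisker (trans (sym (end₁-edge j)) p))
    ... | isEdge j    | inj₂ p = ⊥-elim (edge≢whisker (trans (sym (end₂-edge j)) p))
    ... | isWhisker j | inj₁ p = ⊥-elim (edge≢whisker (trans (sym (end₁-whisker j)) p))
    ... | isWhisker j | inj₂ p = trans (sym (end₂-whisker j)) p

    incident-cycle : ∀ {i e} → e ∈ incident (i ↑ˡ n) → e ≡ edge (prev i) ⊎ e ≡ edge i ⊎ e ≡ whisker i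
    incident-cycle {i} {e} e∈ with edge-cases e | ∈-incident⁻ G {e} e∈
    ... | isEdge j    | inj₁ p = inj₂ (inj₁ (trans (sym (end₁-edge j)) p))
    ... | isEdge j    | inj₂ p = inj₁ (cong edge (next-injective
            (trans (↑ˡ-injective n (succ j) i (trans (sym (end₂-edge j)) p)) (sym (next-prev i)))))
    ... | isWhisker j | inj₁ p = inj₂ (inj₂ (cong whisker
            (↑ˡ-injective n j i (trans (sym (end₁-whisker j)) p))))
    ... | isWhisker j | inj₂ p = ⊥-elim (edge≢whisker (trans (sym p) (end₂-whisker j)))

    -- A leaf meets a single edge. A cycle vertex meets three, one of which is absent from σ, and
    -- the other two bound the degree.
    ¬triple⇒2-matching : ∀ {σ} → ¬ HasTriple σ → Is2Matching σ
    ¬triple⇒2-matching {σ} ¬triple v with edge-cases v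
    ... | isWhisker i = p⊆ab⇒∣p∣≤2 (whisker i) (whisker i)
            (inj₁ ∘ incident-leaf ∘ proj₂ ∘ x∈p∩q⁻ σ (incident (n ↑ʳ i)))
    ... | isEdge i with edge (prev i) ∈? σ | edge i ∈? σ | whisker i ∈? σ
    ... | yes a | yes b | yes c = ⊥-elim (¬triple (prev i , a
            , subst (λ k → edge k ∈ σ) (sym (next-prev i)) b
            , subst (λ k → whisker k ∈ σ) (sym (next-prev i)) c))
    ... | no ¬a | _ | _ = p⊆ab⇒∣p∣≤2 (edge i) (whisker i) λ e∈ →
            let e∈σ , e∈v = x∈p∩q⁻ σ (incident (i ↑ˡ n)) e∈
            in [ (λ { refl → ⊥-elim (¬a e∈σ) }) , id ]′ (incident-cycle e∈v)
    ... | yes _ | no ¬b | _ = p⊆ab⇒∣p∣≤2 (edge (prev i)) (whisker i) λ e∈ →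
            let e∈σ , e∈v = x∈p∩q⁻ σ (incident (i ↑ˡ n)) e∈
            in [ inj₁ , [ (λ { refl → ⊥-elim (¬b e∈σ) }) , inj₂ ]′ ]′ (incident-cycle e∈v)
    ... | yes _ | yes _ | no ¬c = p⊆ab⇒∣p∣≤2 (edge (prev i)) (edge i) λ e∈ →
            let e∈σ , e∈v = x∈p∩q⁻ σ (incident (i ↑ˡ n)) e∈
            in [ inj₁ , [ inj₂ , (λ { refl → ⊥-elim (¬c e∈σ) }) ]′ ]′ (incident-cycle e∈v)

    succ-prev : ∀ i → succ (prev i) ≡ i
    succ-prev i = next-prev i

-- The reals as an ordered ring with inverse square roots, and continuity.

module Reals where

  import Data.Integer.Base as ℤ
  import Data.Integer.Properties as ℤ
  import Data.Nat.Coprimality as ℕ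
  open import Data.Rational.Solver using (module +-*-Solver)
  import Data.Rational.Unnormalised.Base as ℚᵘ
  import Data.Rational.Unnormalised.Properties as ℚᵘ
  open import Relation.Binary.PropositionalEquality using (refl; sym; trans; cong; cong₂; subst; subst₂)
  open import Defs
  open +-*-Solver using (solve; con; _:+_; _:*_; :-_; _:-_; _:=_)

  -- Rational numbers

  0≤q-p⇒p≤q : ∀ {p q} → 0ℚ ℚ.≤ q ℚ.- p → p ℚ.≤ q
  0≤q-p⇒p≤q {p} {q} h = subst₂ ℚ._≤_ (ℚ.+-identityˡ p)
    (solve 2 (λ p q → (q :- p) :+ p := q) refl p q) (ℚ.+-monoˡ-≤ p h)

  p≤q⇒0≤q-p : ∀ {p q} → p ℚ.≤ q → 0ℚ ℚ.≤ q ℚ.- p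
  p≤q⇒0≤q-p {p} {q} h = subst (ℚ._≤ q ℚ.- p) (ℚ.+-inverseʳ p) (ℚ.+-monoˡ-≤ (ℚ.- p) h)

  ≤-witness : ∀ {p q} r → 0ℚ ℚ.≤ r → q ℚ.- p ≡ r → p ℚ.≤ q
  ≤-witness r 0≤r eq = 0≤q-p⇒p≤q (ℚ.≤-trans 0≤r (ℚ.≤-reflexive (sym eq)))

  0≤p+q : ∀ {p q} → 0ℚ ℚ.≤ p → 0ℚ ℚ.≤ q → 0ℚ ℚ.≤ p ℚ.+ q
  0≤p+q 0≤p 0≤q = ℚ.+-mono-≤ 0≤p 0≤q

  0≤p*q : ∀ {p q} → 0ℚ ℚ.≤ p → 0ℚ ℚ.≤ q → 0ℚ ℚ.≤ p ℚ.* q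
  0≤p*q {p} {q} 0≤p 0≤q = subst (ℚ._≤ p ℚ.* q) (ℚ.*-zeroʳ p)
    (ℚ.*-monoˡ-≤-nonNeg p {{ℚ.nonNegative 0≤p}} 0≤q)

  0<p*q : ∀ {p q} → 0ℚ ℚ.< p → 0ℚ ℚ.< q → 0ℚ ℚ.< p ℚ.* q
  0<p*q {p} {q} 0<p 0<q = subst (ℚ._< p ℚ.* q) (ℚ.*-zeroʳ p)
    (ℚ.*-monoʳ-<-pos p {{ℚ.positive 0<p}} 0<q)

  0<½ : 0ℚ ℚ.< ½
  0<½ = ℚ.positive⁻¹ ½

  0≤1 : 0ℚ ℚ.≤ 1ℚ
  0≤1 = ℚ.<⇒≤ (ℚ.positive⁻¹ 1ℚ)

  0<½*p : ∀ {p} → 0ℚ ℚ.< p → 0ℚ ℚ.< ½ ℚ.* p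
  0<½*p = 0<p*q 0<½

  ½p+½p≡p : ∀ p → ½ ℚ.* p ℚ.+ ½ ℚ.* p ≡ p
  ½p+½p≡p = solve 1 (λ p → con ½ :* p :+ con ½ :* p := p) refl

  ½p<p : ∀ {p} → 0ℚ ℚ.< p → ½ ℚ.* p ℚ.< p
  ½p<p {p} 0<p = subst₂ ℚ._<_ (ℚ.+-identityˡ _) (½p+½p≡p p) (ℚ.+-monoˡ-< (½ ℚ.* p) (0<½*p 0<p))

  p≤∣p∣ : ∀ p → p ℚ.≤ ℚ.∣ p ∣
  p≤∣p∣ p with ℚ.≤-total 0ℚ p
  ... | inj₁ 0≤p = ℚ.≤-reflexive (sym (ℚ.0≤p⇒∣p∣≡p 0≤p))
  ... | inj₂ p≤0 = ℚ.≤-trans p≤0 (ℚ.0≤∣p∣ p)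

  ∣p∣≤q : ∀ {p q} → p ℚ.≤ q → ℚ.- p ℚ.≤ q → ℚ.∣ p ∣ ℚ.≤ q
  ∣p∣≤q {p} {q} p≤q -p≤q with ℚ.∣p∣≡p∨∣p∣≡-p p
  ... | inj₁ eq = subst (ℚ._≤ q) (sym eq) p≤q
  ... | inj₂ eq = subst (ℚ._≤ q) (sym eq) -p≤q

  ∣p-q∣≡∣q-p∣ : ∀ p q → ℚ.∣ p ℚ.- q ∣ ≡ ℚ.∣ q ℚ.- p ∣
  ∣p-q∣≡∣q-p∣ p q = trans (sym (ℚ.∣-p∣≡∣p∣ (p ℚ.- q)))
    (cong ℚ.∣_∣ (solve 2 (λ p q → :- (p :- q) := q :- p) refl p q))

  -- Real numbers

  Eventually : (ℕ → Set) → Set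
  Eventually P = ∃ λ N → ∀ n → N ℕ.≤ n → P n

  always : ∀ {P} → (∀ n → P n) → Eventually P
  always h = 0 , λ n _ → h n

  eventually-map : ∀ {P Q} → (∀ n → P n → Q n) → Eventually P → Eventually Q
  eventually-map f (N , h) = N , λ n N≤n → f n (h n N≤n)

  eventually-map₂ : ∀ {P Q R} → (∀ n → P n → Q n → R n) →
    Eventually P → Eventually Q → Eventually R
  eventually-map₂ f (M , g) (N , h) = M ℕ.⊔ N , λ n n≥ →
    f n (g n (ℕ.m⊔n≤o⇒m≤o M N n≥)) (h n (ℕ.m⊔n≤o⇒n≤o M N n≥))

  -- A termwise version of the metric without the strict gap hidden in `_<_`, so estimates combine
  -- by rational arithmetic. Returning to balls costs a factor of one half.
  Close : ℚ → ℝ → ℝ → Set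
  Close ε x y = Eventually λ n → ℚ.∣ seq x n ℚ.- seq y n ∣ ℚ.≤ ε

  ℝ-Ball : ℚ → ℝ → ℝ → Set
  ℝ-Ball = MetricSpace.Ball ℝ-space

  ball⇒close : ∀ {ε} x y → ℝ-Ball ε x y → Close ε x y
  ball⇒close x y (η , 0<η , h) = eventually-map (λ n le → ℚ.≤-trans
    (≤-witness η (ℚ.<⇒≤ 0<η) (solve 2 (λ a η → (a :+ η) :- a := η) refl ℚ.∣ seq x n ℚ.- seq y n ∣ η)) le) h

  close⇒ball : ∀ {ε} x y → 0ℚ ℚ.< ε → Close (½ ℚ.* ε) x y → ℝ-Ball ε x y
  close⇒ball {ε} x y 0<ε h = ½ ℚ.* ε , 0<½*p 0<ε , eventually-map (λ n le →
    ℚ.≤-trans (ℚ.+-monoˡ-≤ (½ ℚ.* ε) le) (ℚ.≤-reflexive (½p+½p≡p ε))) h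

  ≈⇒close : ∀ {x y ε} → x ≈ y → 0ℚ ℚ.< ε → Close ε x y
  ≈⇒close x≈y 0<ε = eventually-map (λ _ → ℚ.<⇒≤) (x≈y _ 0<ε)

  close⇒≈ : ∀ {x y} → (∀ ε → 0ℚ ℚ.< ε → Close ε x y) → x ≈ y
  close⇒≈ h ε 0<ε = eventually-map (λ _ le → ℚ.≤-<-trans le (½p<p 0<ε)) (h (½ ℚ.* ε) (0<½*p 0<ε))

  ≈-pointwise : ∀ {x y} → (∀ n → seq x n ≡ seq y n) → x ≈ y
  ≈-pointwise {x} {y} eq ε 0<ε = always λ n →
    subst (λ r → ℚ.∣ r ℚ.- seq y n ∣ ℚ.< ε) (sym (eq n))
      (subst (λ r → ℚ.∣ r ∣ ℚ.< ε) (sym (ℚ.+-inverseʳ (seq y n))) 0<ε)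

  ≈-refl : ∀ {x} → x ≈ x
  ≈-refl {x} = ≈-pointwise {x} {x} λ _ → refl

  ≈-sym : ∀ {x y} → x ≈ y → y ≈ x
  ≈-sym {x} {y} x≈y ε 0<ε = eventually-map
    (λ n → subst (ℚ._< ε) (∣p-q∣≡∣q-p∣ (seq x n) (seq y n))) (x≈y ε 0<ε)

  ≈-trans : ∀ {x y z} → x ≈ y → y ≈ z → x ≈ z
  ≈-trans {x} {y} {z} x≈y y≈z = close⇒≈ {x} {z} λ ε 0<ε → eventually-map₂
    (λ n p q → begin
      ℚ.∣ seq x n ℚ.- seq z n ∣
        ≡⟨ cong ℚ.∣_∣ (solve 3 (λ x y z → x :- z := (x :- y) :+ (y :- z)) refl (seq x n) (seq y n) (seq z n)) ⟩
      ℚ.∣ (seq x n ℚ.- seq y n) ℚ.+ (seq y n ℚ.- seq z n) ∣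
        ≤⟨ ℚ.∣p+q∣≤∣p∣+∣q∣ (seq x n ℚ.- seq y n) (seq y n ℚ.- seq z n) ⟩
      ℚ.∣ seq x n ℚ.- seq y n ∣ ℚ.+ ℚ.∣ seq y n ℚ.- seq z n ∣
        ≤⟨ ℚ.+-mono-≤ p q ⟩
      ½ ℚ.* ε ℚ.+ ½ ℚ.* ε
        ≡⟨ ½p+½p≡p ε ⟩
      ε ∎)
    (≈⇒close {x} {y} x≈y (0<½*p 0<ε)) (≈⇒close {y} {z} y≈z (0<½*p 0<ε))
    where open ℚ.≤-Reasoning

  -- The form of x ≤ y that mentions no negation.
  _≲_ : ℝ → ℝ → Set
  x ≲ y = ∀ ε → 0ℚ ℚ.< ε → Eventually λ n → seq x n ℚ.≤ seq y n ℚ.+ ε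

  ≲⇒≤ : ∀ {x y} → x ≲ y → x ≤ y
  ≲⇒≤ {x} {y} x≲y (ε , 0<ε , y<x) =
    let N , h = eventually-map₂
          {λ n → seq x n ℚ.≤ seq y n ℚ.+ ½ ℚ.* ε} {λ n → seq y n ℚ.+ ε ℚ.≤ seq x n} {λ _ → ⊥}
          (λ n p q → ℚ.<-irrefl refl (ℚ.<-≤-trans (ℚ.+-monoʳ-< (seq y n) (½p<p 0<ε)) (ℚ.≤-trans q p)))
          (x≲y (½ ℚ.* ε) (0<½*p 0<ε)) y<x
    in h N ℕ.≤-refl

  -- Beyond both moduli each sequence moves by less than ε/4. A single index there with x above y +
  -- ε would keep x above y + ε/2 at all later indices, contradicting x ≤ y; the comparison of
  -- rationals at that index is decidable.
  ≤⇒≲ : ∀ {x y} → x ≤ y → x ≲ y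
  ≤⇒≲ {x} {y} x≤y ε 0<ε = M ℕ.⊔ N , λ n n≥ → body n (ℕ.m⊔n≤o⇒m≤o M N n≥) (ℕ.m⊔n≤o⇒n≤o M N n≥)
    where
    δ = ½ ℚ.* (½ ℚ.* ε)
    0<δ = 0<½*p (0<½*p 0<ε)
    M = proj₁ (cauchy x δ 0<δ)
    N = proj₁ (cauchy y δ 0<δ)
    body : ∀ n → M ℕ.≤ n → N ℕ.≤ n → seq x n ℚ.≤ seq y n ℚ.+ ε
    body n M≤n N≤n with seq x n ℚ.≤? seq y n ℚ.+ ε
    ... | yes p = p
    ... | no ¬p = ⊥-elim (x≤y (½ ℚ.* ε , 0<½*p 0<ε , n , λ k n≤k →
      let a = proj₂ (cauchy x δ 0<δ) n k M≤n (ℕ.≤-trans M≤n n≤k)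
          b = proj₂ (cauchy y δ 0<δ) k n (ℕ.≤-trans N≤n n≤k) N≤n
          c = ℚ.<⇒≤ (ℚ.≰⇒> ¬p)
          a′ = ℚ.≤-trans (p≤∣p∣ (seq x n ℚ.- seq x k)) (ℚ.<⇒≤ a)
          b′ = ℚ.≤-trans (p≤∣p∣ (seq y k ℚ.- seq y n)) (ℚ.<⇒≤ b)
      in ≤-witness _ (0≤p+q (0≤p+q (p≤q⇒0≤q-p a′) (p≤q⇒0≤q-p b′)) (p≤q⇒0≤q-p c))
           (solve 5 (λ xn xk yn yk ε → xk :- (yk :+ con ½ :* ε) :=
              (con ½ :* (con ½ :* ε) :- (xn :- xk) :+ (con ½ :* (con ½ :* ε) :- (yk :- yn)))
                :+ (xn :- (yn :+ ε)))
              refl (seq x n) (seq x k) (seq y n) (seq y k) ε)))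

  ≤-pointwise : ∀ {x y} → (∀ n → seq x n ℚ.≤ seq y n) → x ≤ y
  ≤-pointwise {x} {y} h = ≲⇒≤ {x} {y} λ ε 0<ε → always λ n →
    ℚ.≤-trans (h n) (≤-witness ε (ℚ.<⇒≤ 0<ε) (solve 2 (λ a e → (a :+ e) :- a := e) refl (seq y n) ε))

  ≈⇒≤ : ∀ {x y} → x ≈ y → x ≤ y
  ≈⇒≤ {x} {y} x≈y = ≲⇒≤ {x} {y} λ ε 0<ε → eventually-map
    (λ n p → ≤-witness _ (p≤q⇒0≤q-p (ℚ.≤-trans (p≤∣p∣ (seq x n ℚ.- seq y n)) p))
       (solve 3 (λ x y e → (y :+ e) :- x := e :- (x :- y)) refl (seq x n) (seq y n) ε))
    (≈⇒close {x} {y} x≈y 0<ε)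

  ≤-antisym : ∀ {x y} → x ≤ y → y ≤ x → x ≈ y
  ≤-antisym {x} {y} x≤y y≤x = close⇒≈ {x} {y} λ ε 0<ε → eventually-map₂
    (λ n p q → ∣p∣≤q
      (≤-witness _ (p≤q⇒0≤q-p p)
         (solve 3 (λ x y e → e :- (x :- y) := (y :+ e) :- x) refl (seq x n) (seq y n) ε))
      (≤-witness _ (p≤q⇒0≤q-p q)
         (solve 3 (λ x y e → e :- (:- (x :- y)) := (x :+ e) :- y) refl (seq x n) (seq y n) ε)))
    (≤⇒≲ {x} {y} x≤y ε 0<ε) (≤⇒≲ {y} {x} y≤x ε 0<ε)

  ≤-trans : ∀ {x y z} → x ≤ y → y ≤ z → x ≤ z
  ≤-trans {x} {y} {z} x≤y y≤z = ≲⇒≤ {x} {z} λ ε 0<ε → eventually-map₂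
    (λ n p q → ≤-witness _ (0≤p+q (p≤q⇒0≤q-p p) (p≤q⇒0≤q-p q))
       (solve 4 (λ x y z e → (z :+ e) :- x :=
          ((y :+ con ½ :* e) :- x) :+ ((z :+ con ½ :* e) :- y)) refl (seq x n) (seq y n) (seq z n) ε))
    (≤⇒≲ {x} {y} x≤y (½ ℚ.* ε) (0<½*p 0<ε)) (≤⇒≲ {y} {z} y≤z (½ ℚ.* ε) (0<½*p 0<ε))

  <⇒≤ : ∀ {x y} → x < y → x ≤ y
  <⇒≤ {x} {y} (ε , 0<ε , x<y) (δ , 0<δ , y<x) =
    let N , h = eventually-map₂
          {λ n → seq x n ℚ.+ ε ℚ.≤ seq y n} {λ n → seq y n ℚ.+ δ ℚ.≤ seq x n} {λ _ → ⊥}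
          (λ n p q → ℚ.<-irrefl refl (ℚ.<-≤-trans (ℚ.<-≤-trans (shift (seq x n) 0<ε) p)
                                              (ℚ.≤-trans (ℚ.<⇒≤ (shift (seq y n) 0<δ)) q)))
          x<y y<x
    in h N ℕ.≤-refl
    where
    shift : ∀ a {ε} → 0ℚ ℚ.< ε → a ℚ.< a ℚ.+ ε
    shift a {ε} 0<ε = subst (ℚ._< a ℚ.+ ε) (ℚ.+-identityʳ a) (ℚ.+-monoʳ-< a 0<ε)

  ≤-stable : ∀ {x y} → ¬ (y ≤ x) → x ≤ y
  ≤-stable {x} {y} y≰x y<x = y≰x (<⇒≤ {y} {x} y<x)

  -- Under the assumption b < a both orderings of x and y are refuted, yet refuting y ≤ x already
  -- proves x ≤ y.
  ≤-cases : ∀ {a b} x y → (x ≤ y → a ≤ b) → (y ≤ x → a ≤ b) → a ≤ b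
  ≤-cases {a} {b} x y f g b<a = x≰y (≤-stable {x} {y} y≰x)
    where
    x≰y = λ (x≤y : x ≤ y) → f x≤y b<a
    y≰x = λ (y≤x : y ≤ x) → g y≤x b<a

  -- Algebra of real numbers

  +-nonneg : ∀ {x y} → 0ℝ ≤ x → 0ℝ ≤ y → 0ℝ ≤ x + y
  +-nonneg {x} {y} 0≤x 0≤y = ≲⇒≤ {0ℝ} {x + y} λ ε 0<ε → eventually-map₂
    (λ n p q → ≤-witness _ (0≤p+q (p≤q⇒0≤q-p p) (p≤q⇒0≤q-p q))
       (solve 3 (λ x y e → ((x :+ y) :+ e) :- con 0ℚ :=
          ((x :+ con ½ :* e) :- con 0ℚ) :+ ((y :+ con ½ :* e) :- con 0ℚ)) refl (seq x n) (seq y n) ε))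
    (≤⇒≲ {0ℝ} {x} 0≤x (½ ℚ.* ε) (0<½*p 0<ε)) (≤⇒≲ {0ℝ} {y} 0≤y (½ ℚ.* ε) (0<½*p 0<ε))

  abs-nonneg : ∀ x → 0ℝ ≤ abs x
  abs-nonneg x = ≤-pointwise {0ℝ} {abs x} λ n → ℚ.0≤∣p∣ (seq x n)

  x≤abs : ∀ x → x ≤ abs x
  x≤abs x = ≤-pointwise {x} {abs x} λ n → p≤∣p∣ (seq x n)

  0≤x⇒abs≈x : ∀ {x} → 0ℝ ≤ x → abs x ≈ x
  0≤x⇒abs≈x {x} 0≤x = ≤-antisym {abs x} {x}
    (≲⇒≤ {abs x} {x} λ ε 0<ε → eventually-map
      (λ n p → ∣p∣≤q
        (≤-witness ε (ℚ.<⇒≤ 0<ε) (solve 2 (λ x e → (x :+ e) :- x := e) refl (seq x n) ε))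
        (≤-witness _ (0≤p+q p p) (solve 2 (λ x e → (x :+ e) :- (:- x) :=
           (x :+ con ½ :* e) :+ (x :+ con ½ :* e)) refl (seq x n) ε)))
      (≤⇒≲ {0ℝ} {x} 0≤x (½ ℚ.* ε) (0<½*p 0<ε)))
    (x≤abs x)

  -- Closeness of products also yields the congruence of multiplication.

  eventually-bounded : ∀ x → ∃ λ B → 0ℚ ℚ.≤ B × Eventually λ n → ℚ.∣ seq x n ∣ ℚ.≤ B
  eventually-bounded x with cauchy x 1ℚ (ℚ.positive⁻¹ 1ℚ)
  ... | N , h = 1ℚ ℚ.+ ℚ.∣ seq x N ∣ , 0≤p+q 0≤1 (ℚ.0≤∣p∣ (seq x N)) , N , λ n N≤n → begin
    ℚ.∣ seq x n ∣
      ≡⟨ cong ℚ.∣_∣ (solve 2 (λ a b → a := (a :- b) :+ b) refl (seq x n) (seq x N)) ⟩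
    ℚ.∣ (seq x n ℚ.- seq x N) ℚ.+ seq x N ∣
      ≤⟨ ℚ.∣p+q∣≤∣p∣+∣q∣ (seq x n ℚ.- seq x N) (seq x N) ⟩
    ℚ.∣ seq x n ℚ.- seq x N ∣ ℚ.+ ℚ.∣ seq x N ∣
      ≤⟨ ℚ.+-monoˡ-≤ ℚ.∣ seq x N ∣ (ℚ.<⇒≤ (h n N N≤n ℕ.≤-refl)) ⟩
    1ℚ ℚ.+ ℚ.∣ seq x N ∣ ∎
    where open ℚ.≤-Reasoning

  ∣p*q∣≤ : ∀ {p q P Q} → ℚ.∣ p ∣ ℚ.≤ P → ℚ.∣ q ∣ ℚ.≤ Q → ℚ.∣ p ℚ.* q ∣ ℚ.≤ P ℚ.* Q
  ∣p*q∣≤ {p} {q} {P} {Q} p≤P q≤Q = begin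
    ℚ.∣ p ℚ.* q ∣           ≡⟨ ℚ.∣p*q∣≡∣p∣*∣q∣ p q ⟩
    ℚ.∣ p ∣ ℚ.* ℚ.∣ q ∣     ≤⟨ ℚ.*-monoˡ-≤-nonNeg ℚ.∣ p ∣ {{ℚ.∣-∣-nonNeg p}} q≤Q ⟩
    ℚ.∣ p ∣ ℚ.* Q           ≤⟨ ℚ.*-monoʳ-≤-nonNeg Q {{ℚ.nonNegative (ℚ.≤-trans (ℚ.0≤∣p∣ q) q≤Q)}} p≤P ⟩
    P ℚ.* Q                 ∎
    where open ℚ.≤-Reasoning

  *-modulus : ∀ D → 0ℚ ℚ.< D → ∀ ε → 0ℚ ℚ.< ε →
    ∃ λ δ → 0ℚ ℚ.< δ × δ ℚ.≤ 1ℚ × D ℚ.* δ ℚ.≤ ε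
  *-modulus D 0<D ε 0<ε = choose (ℚ.1/ D ℚ.* ε) (0<p*q 0<1/D 0<ε) D*θ≡ε
    where
    instance
      D-pos : ℚ.Positive D
      D-pos = ℚ.positive 0<D
      D-nonZero : ℚ.NonZero D
      D-nonZero = ℚ.pos⇒nonZero D
    0<1/D : 0ℚ ℚ.< ℚ.1/ D
    0<1/D = ℚ.positive⁻¹ (ℚ.1/ D) {{ℚ.1/pos⇒pos D}}
    D*θ≡ε : D ℚ.* (ℚ.1/ D ℚ.* ε) ≡ ε
    D*θ≡ε = trans (sym (ℚ.*-assoc D (ℚ.1/ D) ε))
      (trans (cong (ℚ._* ε) (ℚ.*-inverseʳ D)) (ℚ.*-identityˡ ε))
    choose : ∀ θ → 0ℚ ℚ.< θ → D ℚ.* θ ≡ ε → ∃ λ δ → 0ℚ ℚ.< δ × δ ℚ.≤ 1ℚ × D ℚ.* δ ℚ.≤ ε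
    choose θ 0<θ Dθ≡ε with ℚ.≤-total 1ℚ θ
    ... | inj₂ θ≤1 = θ , 0<θ , θ≤1 , ℚ.≤-reflexive Dθ≡ε
    ... | inj₁ 1≤θ = 1ℚ , ℚ.positive⁻¹ 1ℚ , ℚ.≤-refl ,
      ℚ.≤-trans (ℚ.*-monoˡ-≤-nonNeg D {{ℚ.nonNegative (ℚ.<⇒≤ 0<D)}} 1≤θ) (ℚ.≤-reflexive Dθ≡ε)

  *-estimate : ∀ {A B δ ε} a b a′ b′ → ℚ.∣ a ∣ ℚ.≤ A → ℚ.∣ b ∣ ℚ.≤ B →
    ℚ.∣ a ℚ.- a′ ∣ ℚ.≤ δ → ℚ.∣ b ℚ.- b′ ∣ ℚ.≤ δ → δ ℚ.≤ 1ℚ → ((A ℚ.+ B) ℚ.+ 1ℚ) ℚ.* δ ℚ.≤ ε →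
    ℚ.∣ a ℚ.* b ℚ.- a′ ℚ.* b′ ∣ ℚ.≤ ε
  *-estimate {A} {B} {δ} {ε} a b a′ b′ a≤ b≤ p q δ≤1 Dδ≤ε = begin
    ℚ.∣ a ℚ.* b ℚ.- a′ ℚ.* b′ ∣
      ≡⟨ cong ℚ.∣_∣ (solve 4 (λ a b a′ b′ → a :* b :- a′ :* b′ :=
           (a :* (b :- b′) :+ (a :- a′) :* b) :- (a :- a′) :* (b :- b′)) refl a b a′ b′) ⟩
    ℚ.∣ (a ℚ.* (b ℚ.- b′) ℚ.+ (a ℚ.- a′) ℚ.* b) ℚ.- (a ℚ.- a′) ℚ.* (b ℚ.- b′) ∣
      ≤⟨ ℚ.∣p-q∣≤∣p∣+∣q∣ (a ℚ.* (b ℚ.- b′) ℚ.+ (a ℚ.- a′) ℚ.* b) ((a ℚ.- a′) ℚ.* (b ℚ.- b′)) ⟩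
    ℚ.∣ a ℚ.* (b ℚ.- b′) ℚ.+ (a ℚ.- a′) ℚ.* b ∣ ℚ.+ ℚ.∣ (a ℚ.- a′) ℚ.* (b ℚ.- b′) ∣
      ≤⟨ ℚ.+-mono-≤
           (ℚ.≤-trans (ℚ.∣p+q∣≤∣p∣+∣q∣ (a ℚ.* (b ℚ.- b′)) ((a ℚ.- a′) ℚ.* b))
             (ℚ.+-mono-≤ (∣p*q∣≤ {a} {b ℚ.- b′} a≤ q) (∣p*q∣≤ {a ℚ.- a′} {b} p b≤)))
           (∣p*q∣≤ {a ℚ.- a′} {b ℚ.- b′} p (ℚ.≤-trans q δ≤1)) ⟩
    (A ℚ.* δ ℚ.+ δ ℚ.* B) ℚ.+ δ ℚ.* 1ℚ
      ≡⟨ solve 3 (λ A B d → (A :* d :+ d :* B) :+ d :* con 1ℚ := ((A :+ B) :+ con 1ℚ) :* d) refl A B δ ⟩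
    ((A ℚ.+ B) ℚ.+ 1ℚ) ℚ.* δ
      ≤⟨ Dδ≤ε ⟩
    ε ∎
    where open ℚ.≤-Reasoning

  -- Bounds A and B for x and y alone suffice: the change of the product is at most Aδ + δB + δ·δ,
  -- and δ ≤ 1 makes this at most (A + B + 1)δ.
  *-close : ∀ x y ε → 0ℚ ℚ.< ε → ∃ λ δ → 0ℚ ℚ.< δ ×
    (∀ x′ y′ → Close δ x x′ → Close δ y y′ → Close ε (x * y) (x′ * y′))
  *-close x y ε 0<ε =
    let A , 0≤A , x≤A = eventually-bounded x
        B , 0≤B , y≤B = eventually-bounded y
        δ , 0<δ , δ≤1 , Dδ≤ε = *-modulus ((A ℚ.+ B) ℚ.+ 1ℚ)
          (ℚ.<-≤-trans (ℚ.positive⁻¹ 1ℚ)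
            (≤-witness _ (0≤p+q 0≤A 0≤B)
              (solve 2 (λ A B → ((A :+ B) :+ con 1ℚ) :- con 1ℚ := A :+ B) refl A B))) ε 0<ε
    in δ , 0<δ , λ x′ y′ cx cy → eventually-map₂
      (λ n (a≤ , b≤) (p , q) → *-estimate (seq x n) (seq y n) (seq x′ n) (seq y′ n) a≤ b≤ p q δ≤1 Dδ≤ε)
      (eventually-map₂ (λ _ → _,_) x≤A y≤B) (eventually-map₂ (λ _ → _,_) cx cy)

  *-cong : ∀ {x x′ y y′} → x ≈ x′ → y ≈ y′ → x * y ≈ x′ * y′
  *-cong {x} {x′} {y} {y′} x≈x′ y≈y′ = close⇒≈ {x * y} {x′ * y′} λ ε 0<ε →
    let δ , 0<δ , h = *-close x y ε 0<ε
    in h x′ y′ (≈⇒close {x} {x′} x≈x′ 0<δ) (≈⇒close {y} {y′} y≈y′ 0<δ)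

  +-close : ∀ {ε} x y x′ y′ → Close (½ ℚ.* ε) x x′ → Close (½ ℚ.* ε) y y′ → Close ε (x + y) (x′ + y′)
  +-close {ε} x y x′ y′ = eventually-map₂ λ n p q → begin
    ℚ.∣ (seq x n ℚ.+ seq y n) ℚ.- (seq x′ n ℚ.+ seq y′ n) ∣
      ≡⟨ cong ℚ.∣_∣ (solve 4 (λ x y x′ y′ → (x :+ y) :- (x′ :+ y′) := (x :- x′) :+ (y :- y′)) refl
           (seq x n) (seq y n) (seq x′ n) (seq y′ n)) ⟩
    ℚ.∣ (seq x n ℚ.- seq x′ n) ℚ.+ (seq y n ℚ.- seq y′ n) ∣
      ≤⟨ ℚ.∣p+q∣≤∣p∣+∣q∣ (seq x n ℚ.- seq x′ n) (seq y n ℚ.- seq y′ n) ⟩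
    ℚ.∣ seq x n ℚ.- seq x′ n ∣ ℚ.+ ℚ.∣ seq y n ℚ.- seq y′ n ∣
      ≤⟨ ℚ.+-mono-≤ p q ⟩
    ½ ℚ.* ε ℚ.+ ½ ℚ.* ε
      ≡⟨ ½p+½p≡p ε ⟩
    ε ∎
    where open ℚ.≤-Reasoning

  +-cong : ∀ {x x′ y y′} → x ≈ x′ → y ≈ y′ → x + y ≈ x′ + y′
  +-cong {x} {x′} {y} {y′} x≈x′ y≈y′ = close⇒≈ {x + y} {x′ + y′} λ ε 0<ε →
    +-close x y x′ y′ (≈⇒close {x} {x′} x≈x′ (0<½*p 0<ε)) (≈⇒close {y} {y′} y≈y′ (0<½*p 0<ε))

  neg-close : ∀ {ε} x x′ → Close ε x x′ → Close ε (- x) (- x′)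
  neg-close {ε} x x′ = eventually-map λ n → subst (ℚ._≤ ε)
    (trans (∣p-q∣≡∣q-p∣ (seq x n) (seq x′ n))
      (cong ℚ.∣_∣ (solve 2 (λ a b → b :- a := (:- a) :- (:- b)) refl (seq x n) (seq x′ n))))

  neg-cong : ∀ {x x′} → x ≈ x′ → - x ≈ - x′
  neg-cong {x} {x′} x≈x′ = close⇒≈ { - x} { - x′} λ ε 0<ε → neg-close x x′ (≈⇒close {x} {x′} x≈x′ 0<ε)

  abs-close : ∀ {ε} x x′ → Close ε x x′ → Close ε (abs x) (abs x′)
  abs-close {ε} x x′ = eventually-map λ n p → ∣p∣≤q
    (ℚ.≤-trans (le (seq x n) (seq x′ n)) p)
    (subst (ℚ._≤ ε) (solve 2 (λ a b → b :- a := :- (a :- b)) refl ℚ.∣ seq x n ∣ ℚ.∣ seq x′ n ∣)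
      (ℚ.≤-trans (le (seq x′ n) (seq x n)) (subst (ℚ._≤ ε) (∣p-q∣≡∣q-p∣ (seq x n) (seq x′ n)) p)))
    where
    le : ∀ p q → ℚ.∣ p ∣ ℚ.- ℚ.∣ q ∣ ℚ.≤ ℚ.∣ p ℚ.- q ∣
    le p q = ≤-witness _ (p≤q⇒0≤q-p (ℚ.≤-trans
        (ℚ.≤-reflexive (cong ℚ.∣_∣ (solve 2 (λ p q → p := (p :- q) :+ q) refl p q)))
        (ℚ.∣p+q∣≤∣p∣+∣q∣ (p ℚ.- q) q)))
      (solve 3 (λ a b c → c :- (a :- b) := (c :+ b) :- a) refl ℚ.∣ p ∣ ℚ.∣ q ∣ ℚ.∣ p ℚ.- q ∣)

  abs-cong : ∀ {x x′} → x ≈ x′ → abs x ≈ abs x′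
  abs-cong {x} {x′} x≈x′ = close⇒≈ {abs x} {abs x′} λ ε 0<ε → abs-close x x′ (≈⇒close {x} {x′} x≈x′ 0<ε)

  -- Inverse square roots

  halves : ℕ → ℚ
  halves zero    = 1ℚ
  halves (suc k) = ½ ℚ.* halves k

  0<halves : ∀ k → 0ℚ ℚ.< halves k
  0<halves zero    = ℚ.positive⁻¹ 1ℚ
  0<halves (suc k) = 0<½*p (0<halves k)

  0≤halves : ∀ k → 0ℚ ℚ.≤ halves k
  0≤halves k = ℚ.<⇒≤ (0<halves k)

  halves≤1 : ∀ k → halves k ℚ.≤ 1ℚ
  halves≤1 zero    = ℚ.≤-refl
  halves≤1 (suc k) = ℚ.≤-trans (ℚ.<⇒≤ (½p<p (0<halves k))) (halves≤1 k)

  -- The rational k + 1; the shift keeps it positive and hence invertible.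
  fromℕ⁺ : ℕ → ℚ
  fromℕ⁺ k = mkℚ ℤ.+[1+ k ] 0 (ℕ.sym (ℕ.1-coprimeTo (suc k)))

  fromℕ⁺-suc : ∀ k → fromℕ⁺ (suc k) ≡ fromℕ⁺ k ℚ.+ 1ℚ
  fromℕ⁺-suc k = ℚ.toℚᵘ-injective (ℚᵘ.≃-trans
    (ℚᵘ.*≡* (cong (ℤ._* ℤ.1ℤ) (cong ℤ.+_
      (trans (ℕ.+-comm 1 (suc k)) (cong (ℕ._+ 1) (sym (ℕ.*-identityʳ (suc k))))))))
    (ℚᵘ.≃-sym (ℚ.toℚᵘ-homo-+ (fromℕ⁺ k) 1ℚ)))

  fromℕ⁺-mono : ∀ {k l} → k ℕ.≤ l → fromℕ⁺ k ℚ.≤ fromℕ⁺ l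
  fromℕ⁺-mono k≤l = ℚ.*≤* (ℤ.*-monoʳ-≤-nonNeg ℤ.1ℤ (ℤ.+≤+ (ℕ.s≤s k≤l)))

  halves*fromℕ⁺≤1 : ∀ k → halves k ℚ.* fromℕ⁺ k ℚ.≤ 1ℚ
  halves*fromℕ⁺≤1 zero    = ℚ.≤-refl
  halves*fromℕ⁺≤1 (suc k) = subst (λ r → halves (suc k) ℚ.* r ℚ.≤ 1ℚ) (sym (fromℕ⁺-suc k))
    (≤-witness _ (0≤p*q (ℚ.<⇒≤ 0<½)
        (0≤p+q (p≤q⇒0≤q-p (halves*fromℕ⁺≤1 k)) (p≤q⇒0≤q-p (halves≤1 k))))
      (solve 2 (λ h c → con 1ℚ :- (con ½ :* h) :* (c :+ con 1ℚ) :=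
         con ½ :* ((con 1ℚ :- h :* c) :+ (con 1ℚ :- h))) refl (halves k) (fromℕ⁺ k)))

  archimedean : ∀ {ε} → 0ℚ ℚ.< ε → ∃ λ k → 1ℚ ℚ.≤ ε ℚ.* fromℕ⁺ k
  archimedean {ε} 0<ε with ε | ℚ.positive 0<ε
  -- Here ε = (a+1)/(d+1), so multiplying by d + 1 gives a + 1 ≥ 1.
  ... | mkℚ ℤ.+[1+ a ] d c | _ = d , ℚ.≤-trans
    (ℚ.≤-reflexive (sym (ℚ.*-inverseˡ (fromℕ⁺ d))))
    (ℚ.*-monoʳ-≤-nonNeg (fromℕ⁺ d) {ℚ.1/ fromℕ⁺ d} {mkℚ ℤ.+[1+ a ] d c}
      (ℚ.*≤* (ℤ.*-monoʳ-≤-nonNeg ℤ.+[1+ d ] {ℤ.1ℤ} {ℤ.+[1+ a ]} (ℤ.+≤+ (ℕ.s≤s ℕ.z≤n)))))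

  halves-null : ∀ {ε} → 0ℚ ℚ.< ε → Eventually λ k → halves k ℚ.≤ ε
  halves-null {ε} 0<ε with archimedean 0<ε
  ... | N , 1≤εN = N , λ k N≤k → ≤-witness _
    (0≤p+q (0≤p*q (ℚ.<⇒≤ 0<ε) (p≤q⇒0≤q-p (halves*fromℕ⁺≤1 k)))
      (0≤p*q (0≤halves k) (p≤q⇒0≤q-p (ℚ.≤-trans 1≤εN
        (ℚ.*-monoˡ-≤-nonNeg ε {{ℚ.nonNegative (ℚ.<⇒≤ 0<ε)}} (fromℕ⁺-mono N≤k))))))
    (solve 3 (λ e h c → e :- h := e :* (con 1ℚ :- h :* c) :+ h :* (e :* c :- con 1ℚ))
       refl ε (halves k) (fromℕ⁺ k))

  -- An interval of length h containing 1/√q, expressed by squares so that neither roots nor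
  -- quotients occur.
  record Bracket (q h : ℚ) : Set where
    field
      lower     : ℚ
      0≤lower   : 0ℚ ℚ.≤ lower
      lower²q≤1 : lower ℚ.* lower ℚ.* q ℚ.≤ 1ℚ
      1≤upper²q : 1ℚ ℚ.≤ (lower ℚ.+ h) ℚ.* (lower ℚ.+ h) ℚ.* q

  open Bracket

  -- Bisection starts from the interval from 0 to 1, which contains 1/√q because q ≥ 1.
  bisect : ∀ q → 1ℚ ℚ.≤ q → ∀ k → Bracket q (halves k)
  bisect q 1≤q zero = record
    { lower     = 0ℚ
    ; 0≤lower   = ℚ.≤-refl
    ; lower²q≤1 = ℚ.≤-trans (ℚ.≤-reflexive (ℚ.*-zeroˡ q)) 0≤1
    ; 1≤upper²q = ℚ.≤-trans 1≤q (ℚ.≤-reflexive (sym (ℚ.*-identityˡ q)))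
    }
  bisect q 1≤q (suc k) with bisect q 1≤q k
  ... | B with (lower B ℚ.+ halves (suc k)) ℚ.* (lower B ℚ.+ halves (suc k)) ℚ.* q ℚ.≤? 1ℚ
  ... | yes mid²q≤1 = record
    { lower     = lower B ℚ.+ halves (suc k)
    ; 0≤lower   = 0≤p+q (0≤lower B) (0≤halves (suc k))
    ; lower²q≤1 = mid²q≤1
    ; 1≤upper²q = subst (λ r → 1ℚ ℚ.≤ r ℚ.* r ℚ.* q)
        (solve 2 (λ l h → l :+ h := (l :+ con ½ :* h) :+ con ½ :* h) refl (lower B) (halves k))
        (1≤upper²q B)
    }
  ... | no mid²q≰1 = record
    { lower     = lower B
    ; 0≤lower   = 0≤lower B
    ; lower²q≤1 = lower²q≤1 B
    ; 1≤upper²q = ℚ.<⇒≤ (ℚ.≰⇒> mid²q≰1)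
    }

  a²p≤1≤c²p⇒a≤c : ∀ {a c p} → 0ℚ ℚ.≤ c → 0ℚ ℚ.< p →
    a ℚ.* a ℚ.* p ℚ.≤ 1ℚ → 1ℚ ℚ.≤ c ℚ.* c ℚ.* p → a ℚ.≤ c
  a²p≤1≤c²p⇒a≤c {a} {c} {p} 0≤c 0<p a²p≤1 1≤c²p with a ℚ.≤? c
  ... | yes a≤c = a≤c
  ... | no a≰c = ⊥-elim (ℚ.<-irrefl refl (ℚ.<-≤-trans 0<product product≤0))
    where
    0<a-c : 0ℚ ℚ.< a ℚ.- c
    0<a-c = subst (ℚ._< a ℚ.- c) (ℚ.+-inverseʳ c) (ℚ.+-monoˡ-< (ℚ.- c) (ℚ.≰⇒> a≰c))
    0<product : 0ℚ ℚ.< ((a ℚ.- c) ℚ.* ((a ℚ.- c) ℚ.+ (c ℚ.+ c))) ℚ.* p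
    0<product = 0<p*q (0<p*q 0<a-c (ℚ.<-≤-trans 0<a-c
      (≤-witness _ (0≤p+q 0≤c 0≤c)
        (solve 2 (λ d e → (d :+ e) :- d := e) refl (a ℚ.- c) (c ℚ.+ c))))) 0<p
    product≤0 : ((a ℚ.- c) ℚ.* ((a ℚ.- c) ℚ.+ (c ℚ.+ c))) ℚ.* p ℚ.≤ 0ℚ
    product≤0 = ≤-witness _ (0≤p+q (p≤q⇒0≤q-p a²p≤1) (p≤q⇒0≤q-p 1≤c²p))
      (solve 3 (λ a c p → con 0ℚ :- ((a :- c) :* ((a :- c) :+ (c :+ c))) :* p :=
         (con 1ℚ :- a :* a :* p) :+ (c :* c :* p :- con 1ℚ)) refl a c p)

  -- A Lipschitz bound for 1/√ on [1, ∞), where a ≤ 1/√p and b ≥ 1/√q. If b ≥ 1, then a ≤ 1 ≤ b. If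
  -- b ≤ 1, the hypotheses give (b + d)² p ≥ 1, and squares are compared.
  bracket-lipschitz : ∀ {a b p q d} → 0ℚ ℚ.≤ b → 1ℚ ℚ.≤ p → 0ℚ ℚ.≤ d → q ℚ.≤ p ℚ.+ d →
    a ℚ.* a ℚ.* p ℚ.≤ 1ℚ → 1ℚ ℚ.≤ b ℚ.* b ℚ.* q → a ℚ.≤ b ℚ.+ d
  bracket-lipschitz {a} {b} {p} {q} {d} 0≤b 1≤p 0≤d q≤p+d a²p≤1 1≤b²q with ℚ.≤-total b 1ℚ
  ... | inj₂ 1≤b = ℚ.≤-trans
    (a²p≤1≤c²p⇒a≤c 0≤1 (ℚ.<-≤-trans (ℚ.positive⁻¹ 1ℚ) 1≤p) a²p≤1
      (ℚ.≤-trans 1≤p (ℚ.≤-reflexive (sym (ℚ.*-identityˡ p)))))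
    (≤-witness _ (0≤p+q 0≤d (p≤q⇒0≤q-p 1≤b))
      (solve 2 (λ b d → (b :+ d) :- con 1ℚ := d :+ (b :- con 1ℚ)) refl b d))
  ... | inj₁ b≤1 = a²p≤1≤c²p⇒a≤c (0≤p+q 0≤b 0≤d) (ℚ.<-≤-trans (ℚ.positive⁻¹ 1ℚ) 1≤p) a²p≤1
    (≤-witness _
      (0≤p+q (0≤p+q (0≤p+q (p≤q⇒0≤q-p 1≤b²q) (0≤p*q (0≤p*q 0≤b 0≤b) (p≤q⇒0≤q-p q≤p+d)))
                    (0≤p*q (0≤p*q 0≤b 0≤d) (p≤q⇒0≤q-p b≤1)))
             (0≤p+q (0≤p*q (0≤p*q 0≤b 0≤d) (0≤p+q (p≤q⇒0≤q-p 1≤p) 0≤p))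
                    (0≤p*q (0≤p*q 0≤d 0≤d) 0≤p)))
      (solve 4 (λ b p q d → (b :+ d) :* (b :+ d) :* p :- con 1ℚ :=
         (((b :* b :* q :- con 1ℚ) :+ b :* b :* ((p :+ d) :- q)) :+ b :* d :* (con 1ℚ :- b))
           :+ (b :* d :* ((p :- con 1ℚ) :+ p) :+ d :* d :* p)) refl b p q d))
    where
    0≤p : 0ℚ ℚ.≤ p
    0≤p = ℚ.≤-trans 0≤1 1≤p

  clamp : ℚ → ℚ
  clamp q = q ℚ.⊔ 1ℚ

  1≤clamp : ∀ q → 1ℚ ℚ.≤ clamp q
  1≤clamp q = ℚ.p≤q⊔p q 1ℚ

  p≤q+∣p-q∣ : ∀ p q → p ℚ.≤ q ℚ.+ ℚ.∣ p ℚ.- q ∣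
  p≤q+∣p-q∣ p q = ≤-witness _ (p≤q⇒0≤q-p (p≤∣p∣ (p ℚ.- q)))
    (solve 3 (λ p q d → (q :+ d) :- p := d :- (p :- q)) refl p q ℚ.∣ p ℚ.- q ∣)

  clamp-lipschitz : ∀ p q → clamp p ℚ.≤ clamp q ℚ.+ ℚ.∣ p ℚ.- q ∣
  clamp-lipschitz p q = ℚ.⊔-lub
    (ℚ.≤-trans (p≤q+∣p-q∣ p q) (ℚ.+-monoˡ-≤ ℚ.∣ p ℚ.- q ∣ (ℚ.p≤p⊔q q 1ℚ)))
    (ℚ.≤-trans (ℚ.≤-reflexive (sym (ℚ.+-identityʳ 1ℚ))) (ℚ.+-mono-≤ (1≤clamp q) (ℚ.0≤∣p∣ (p ℚ.- q))))

  bracket : ∀ k q → Bracket (clamp q) (halves k)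
  bracket k q = bisect (clamp q) (1≤clamp q) k

  rsqrt : ℕ → ℚ → ℚ
  rsqrt k q = lower (bracket k q)

  -- The upper end at precision n dominates lower ends of every precision m. Allowing m and n to
  -- differ makes one estimate serve both the Cauchy property and the continuity of `ρ`.
  rsqrt-≤ : ∀ m n p q → rsqrt m p ℚ.≤ rsqrt n q ℚ.+ (ℚ.∣ p ℚ.- q ∣ ℚ.+ halves n)
  rsqrt-≤ m n p q = ℚ.≤-trans
    (bracket-lipschitz (0≤p+q (0≤lower (bracket n q)) (0≤halves n)) (1≤clamp p) (ℚ.0≤∣p∣ (p ℚ.- q))
      (subst (λ d → clamp q ℚ.≤ clamp p ℚ.+ d) (∣p-q∣≡∣q-p∣ q p) (clamp-lipschitz q p))
      (lower²q≤1 (bracket m p)) (1≤upper²q (bracket n q)))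
    (ℚ.≤-reflexive (solve 3 (λ r h d → (r :+ h) :+ d := r :+ (d :+ h)) refl
      (rsqrt n q) (halves n) ℚ.∣ p ℚ.- q ∣))

  ∣rsqrt-rsqrt∣≤ : ∀ {η θ} m n p q → ℚ.∣ p ℚ.- q ∣ ℚ.≤ η → halves m ℚ.≤ θ → halves n ℚ.≤ θ →
    ℚ.∣ rsqrt m p ℚ.- rsqrt n q ∣ ℚ.≤ η ℚ.+ θ
  ∣rsqrt-rsqrt∣≤ {η} {θ} m n p q d≤ hm≤ hn≤ = ∣p∣≤q
    (≤-witness _ (0≤p+q (p≤q⇒0≤q-p (rsqrt-≤ m n p q)) (p≤q⇒0≤q-p (ℚ.+-mono-≤ d≤ hn≤)))
      (solve 4 (λ r s t u → t :- (r :- s) := ((s :+ u) :- r) :+ (t :- u)) refl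
        (rsqrt m p) (rsqrt n q) (η ℚ.+ θ) (ℚ.∣ p ℚ.- q ∣ ℚ.+ halves n)))
    (≤-witness _ (0≤p+q (p≤q⇒0≤q-p (rsqrt-≤ n m q p))
        (p≤q⇒0≤q-p (ℚ.+-mono-≤ (subst (ℚ._≤ η) (∣p-q∣≡∣q-p∣ p q) d≤) hm≤)))
      (solve 4 (λ r s t u → t :- (:- (r :- s)) := ((r :+ u) :- s) :+ (t :- u)) refl
        (rsqrt m p) (rsqrt n q) (η ℚ.+ θ) (ℚ.∣ q ℚ.- p ∣ ℚ.+ halves m)))

  clampℝ : ℝ → ℝ
  clampℝ x = mkℝ (λ k → clamp (seq x k)) λ ε 0<ε →
    let N , h = cauchy x ε 0<ε
    in N , λ m n m≥ n≥ → ℚ.≤-<-trans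
         (∣p∣≤q
           (≤-witness _ (p≤q⇒0≤q-p (clamp-lipschitz (seq x m) (seq x n)))
             (solve 3 (λ a b d → d :- (a :- b) := (b :+ d) :- a) refl
               (clamp (seq x m)) (clamp (seq x n)) ℚ.∣ seq x m ℚ.- seq x n ∣))
           (≤-witness _ (p≤q⇒0≤q-p (subst (λ d → clamp (seq x n) ℚ.≤ clamp (seq x m) ℚ.+ d)
               (∣p-q∣≡∣q-p∣ (seq x n) (seq x m)) (clamp-lipschitz (seq x n) (seq x m))))
             (solve 3 (λ a b d → d :- (:- (a :- b)) := (a :+ d) :- b) refl
               (clamp (seq x m)) (clamp (seq x n)) ℚ.∣ seq x m ℚ.- seq x n ∣)))
         (h m n m≥ n≥)

  1≤x⇒clampℝ≈x : ∀ {x} → 1ℝ ≤ x → clampℝ x ≈ x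
  1≤x⇒clampℝ≈x {x} 1≤x = ≤-antisym {clampℝ x} {x}
    (≲⇒≤ {clampℝ x} {x} λ ε 0<ε → eventually-map
      (λ n p → ℚ.⊔-lub
        (≤-witness ε (ℚ.<⇒≤ 0<ε) (solve 2 (λ x e → (x :+ e) :- x := e) refl (seq x n) ε)) p)
      (≤⇒≲ {1ℝ} {x} 1≤x ε 0<ε))
    (≤-pointwise {x} {clampℝ x} λ n → ℚ.p≤p⊔q (seq x n) 1ℚ)

  -- The bracket lengths as a representative of 0: adding it to `ρ x` turns lower ends into upper
  -- ends.
  nullℝ : ℝ
  nullℝ = mkℝ halves λ ε 0<ε →
    let N , h = halves-null (0<½*p (0<½*p 0<ε))
    in N , λ m n m≥ n≥ → ℚ.≤-<-trans
         (ℚ.≤-trans (ℚ.∣p-q∣≤∣p∣+∣q∣ (halves m) (halves n))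
           (ℚ.≤-trans (ℚ.≤-reflexive (cong₂ ℚ._+_ (ℚ.0≤p⇒∣p∣≡p (0≤halves m)) (ℚ.0≤p⇒∣p∣≡p (0≤halves n))))
             (ℚ.+-mono-≤ (h m m≥) (h n n≥))))
         (subst (ℚ._< ε) (sym (½p+½p≡p (½ ℚ.* ε))) (½p<p 0<ε))

  nullℝ≈0 : nullℝ ≈ 0ℝ
  nullℝ≈0 = close⇒≈ {nullℝ} {0ℝ} λ ε 0<ε → eventually-map
    (λ n h → ℚ.≤-trans (ℚ.≤-reflexive (trans (cong ℚ.∣_∣ (ℚ.+-identityʳ (halves n)))
      (ℚ.0≤p⇒∣p∣≡p (0≤halves n)))) h) (halves-null 0<ε)

  -- ρ x is the inverse square root of max(x, 1).
  -- It is abstract because its unfolding slows down conversion checking.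
  abstract

    ρ : ℝ → ℝ
    ρ x = mkℝ (λ k → rsqrt k (seq x k)) λ ε 0<ε →
      let δ = ½ ℚ.* (½ ℚ.* ε)
          0<δ = 0<½*p (0<½*p 0<ε)
          M , hx = cauchy x δ 0<δ
          N , hh = halves-null 0<δ
      in M ℕ.⊔ N , λ m n m≥ n≥ → ℚ.≤-<-trans
           (∣rsqrt-rsqrt∣≤ {δ} {δ} m n (seq x m) (seq x n)
             (ℚ.<⇒≤ (hx m n (ℕ.m⊔n≤o⇒m≤o M N m≥) (ℕ.m⊔n≤o⇒m≤o M N n≥)))
             (hh m (ℕ.m⊔n≤o⇒n≤o M N m≥)) (hh n (ℕ.m⊔n≤o⇒n≤o M N n≥)))
           (subst (ℚ._< ε) (sym (½p+½p≡p (½ ℚ.* ε))) (½p<p 0<ε))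

    ρ-close : ∀ {ε} x x′ → 0ℚ ℚ.< ε → Close (½ ℚ.* ε) x x′ → Close ε (ρ x) (ρ x′)
    ρ-close {ε} x x′ 0<ε c = eventually-map₂
      (λ n p h → subst (ℚ.∣ rsqrt n (seq x n) ℚ.- rsqrt n (seq x′ n) ∣ ℚ.≤_) (½p+½p≡p ε)
        (∣rsqrt-rsqrt∣≤ n n (seq x n) (seq x′ n) p h h))
      c (halves-null (0<½*p 0<ε))

    ρ-cong : ∀ {x x′} → x ≈ x′ → ρ x ≈ ρ x′
    ρ-cong {x} {x′} x≈x′ = close⇒≈ {ρ x} {ρ x′} λ ε 0<ε →
      ρ-close x x′ 0<ε (≈⇒close {x} {x′} x≈x′ (0<½*p 0<ε))

    ρ-nonneg : ∀ x → 0ℝ ≤ ρ x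
    ρ-nonneg x = ≤-pointwise {0ℝ} {ρ x} λ n → 0≤lower (bracket n (seq x n))

    -- Termwise, the lower ends give a product at most 1 and the upper ends one at least 1; as
    -- reals, both sequences of ends equal `ρ x`.
    ρ²x≈1 : ∀ {x} → 1ℝ ≤ x → (ρ x * ρ x) * x ≈ 1ℝ
    ρ²x≈1 {x} 1≤x = ≈-trans {(ρ x * ρ x) * x} {(ρ x * ρ x) * clampℝ x} {1ℝ}
      (*-cong {ρ x * ρ x} {ρ x * ρ x} {x} {clampℝ x} (≈-refl {ρ x * ρ x})
        (≈-sym {clampℝ x} {x} (1≤x⇒clampℝ≈x {x} 1≤x)))
      (≤-antisym {(ρ x * ρ x) * clampℝ x} {1ℝ}
        (≤-pointwise {(ρ x * ρ x) * clampℝ x} {1ℝ} λ n → lower²q≤1 (bracket n (seq x n)))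
        (≤-trans {1ℝ} {(r * r) * clampℝ x} {(ρ x * ρ x) * clampℝ x}
          (≤-pointwise {1ℝ} {(r * r) * clampℝ x} λ n → 1≤upper²q (bracket n (seq x n)))
          (≈⇒≤ {(r * r) * clampℝ x} {(ρ x * ρ x) * clampℝ x}
            (*-cong {r * r} {ρ x * ρ x} {clampℝ x} {clampℝ x}
              (*-cong {r} {ρ x} {r} {ρ x} r≈ρ r≈ρ) (≈-refl {clampℝ x})))))
      where
      r : ℝ
      r = ρ x + nullℝ
      r≈ρ : r ≈ ρ x
      r≈ρ = ≈-trans {r} {ρ x + 0ℝ} {ρ x}
        (+-cong {ρ x} {ρ x} {nullℝ} {0ℝ} (≈-refl {ρ x}) nullℝ≈0)
        (≈-pointwise {ρ x + 0ℝ} {ρ x} λ n → ℚ.+-identityʳ (seq (ρ x) n))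

  -- The ordered ring of real numbers

  ∣p∣*∣p∣≡p*p : ∀ p → ℚ.∣ p ∣ ℚ.* ℚ.∣ p ∣ ≡ p ℚ.* p
  ∣p∣*∣p∣≡p*p p with ℚ.∣p∣≡p∨∣p∣≡-p p
  ... | inj₁ eq = cong₂ ℚ._*_ eq eq
  ... | inj₂ eq = trans (cong₂ ℚ._*_ eq eq) (solve 1 (λ p → (:- p) :* (:- p) := p :* p) refl p)

  -- Copies of the operations that do not unfold: comparing the Cauchy moduli hidden in compound
  -- expressions is prohibitively expensive.
  abstract

    infixl 6 _⊞_
    infixl 7 _⊠_
    infix  8 ⊟_

    _⊞_ _⊠_ : ℝ → ℝ → ℝ
    _⊞_ = _+_
    _⊠_ = _*_

    ⊟_ ∣_∣ℝ : ℝ → ℝ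
    ⊟_ = -_
    ∣_∣ℝ = abs

    seq-⊞ : ∀ x y k → seq (x ⊞ y) k ≡ seq x k ℚ.+ seq y k
    seq-⊞ x y k = refl

    seq-⊠ : ∀ x y k → seq (x ⊠ y) k ≡ seq x k ℚ.* seq y k
    seq-⊠ x y k = refl

    ℝ-isCommutativeRing : IsCommutativeRing _≈_ _⊞_ _⊠_ ⊟_ 0ℝ 1ℝ
    ℝ-isCommutativeRing = record
      { isRing = record
        { +-isAbelianGroup = record
          { isGroup = record
            { isMonoid = record
              { isSemigroup = record
                { isMagma = record
                  { isEquivalence = record
                    { refl  = λ {x} → ≈-refl {x}
                    ; sym   = λ {x y} → ≈-sym {x} {y}
                    ; trans = λ {x y z} → ≈-trans {x} {y} {z}
                    }
                  ; ∙-cong = λ {x x′ y y′} → +-cong {x} {x′} {y} {y′}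
                  }
                ; assoc = λ x y z → ≈-pointwise {(x + y) + z} {x + (y + z)}
                    λ n → ℚ.+-assoc (seq x n) (seq y n) (seq z n)
                }
              ; identity = (λ x → ≈-pointwise {0ℝ + x} {x} λ n → ℚ.+-identityˡ (seq x n))
                         , (λ x → ≈-pointwise {x + 0ℝ} {x} λ n → ℚ.+-identityʳ (seq x n))
              }
            ; inverse = (λ x → ≈-pointwise {(- x) + x} {0ℝ} λ n → ℚ.+-inverseˡ (seq x n))
                      , (λ x → ≈-pointwise {x - x} {0ℝ} λ n → ℚ.+-inverseʳ (seq x n))
            ; ⁻¹-cong = λ {x x′} → neg-cong {x} {x′}
            }
          ; comm = λ x y → ≈-pointwise {x + y} {y + x} λ n → ℚ.+-comm (seq x n) (seq y n)
          }
        ; *-cong = λ {x x′ y y′} → *-cong {x} {x′} {y} {y′}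
        ; *-assoc = λ x y z → ≈-pointwise {(x * y) * z} {x * (y * z)}
            λ n → ℚ.*-assoc (seq x n) (seq y n) (seq z n)
        ; *-identity = (λ x → ≈-pointwise {1ℝ * x} {x} λ n → ℚ.*-identityˡ (seq x n))
                     , (λ x → ≈-pointwise {x * 1ℝ} {x} λ n → ℚ.*-identityʳ (seq x n))
        ; distrib = (λ x y z → ≈-pointwise {x * (y + z)} {x * y + x * z}
                       λ n → ℚ.*-distribˡ-+ (seq x n) (seq y n) (seq z n))
                  , (λ x y z → ≈-pointwise {(y + z) * x} {y * x + z * x}
                       λ n → ℚ.*-distribʳ-+ (seq x n) (seq y n) (seq z n))
        }
      ; *-comm = λ x y → ≈-pointwise {x * y} {y * x} λ n → ℚ.*-comm (seq x n) (seq y n)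
      }

    fromℚ-⊞ : ∀ p q → fromℚ (p ℚ.+ q) ≈ fromℚ p ⊞ fromℚ q
    fromℚ-⊞ p q = ≈-refl {fromℚ p + fromℚ q}

    fromℚ-⊠ : ∀ p q → fromℚ (p ℚ.* q) ≈ fromℚ p ⊠ fromℚ q
    fromℚ-⊠ p q = ≈-refl {fromℚ p * fromℚ q}

    fromℚ-⊟ : ∀ p → fromℚ (ℚ.- p) ≈ ⊟ fromℚ p
    fromℚ-⊟ p = ≈-refl { - fromℚ p}

    x≤y⇒0≤y⊟x : ∀ {x y} → x ≤ y → 0ℝ ≤ y ⊞ ⊟ x
    x≤y⇒0≤y⊟x {x} {y} x≤y = ≲⇒≤ {0ℝ} {y - x} λ ε 0<ε → eventually-map
      (λ n p → ℚ.≤-trans (p≤q⇒0≤q-p p) (ℚ.≤-reflexive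
        (solve 3 (λ x y e → (y :+ e) :- x := (y :- x) :+ e) refl (seq x n) (seq y n) ε)))
      (≤⇒≲ {x} {y} x≤y ε 0<ε)

    0≤y⊟x⇒x≤y : ∀ {x y} → 0ℝ ≤ y ⊞ ⊟ x → x ≤ y
    0≤y⊟x⇒x≤y {x} {y} 0≤y-x = ≲⇒≤ {x} {y} λ ε 0<ε → eventually-map
      (λ n p → ≤-witness _ p
        (solve 3 (λ x y e → (y :+ e) :- x := (y :- x) :+ e) refl (seq x n) (seq y n) ε))
      (≤⇒≲ {0ℝ} {y - x} 0≤y-x ε 0<ε)

    ⊞-nonneg : ∀ {x y} → 0ℝ ≤ x → 0ℝ ≤ y → 0ℝ ≤ x ⊞ y
    ⊞-nonneg {x} {y} = +-nonneg {x} {y}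

    ∣⊠∣ℝ : ∀ x y → ∣ x ⊠ y ∣ℝ ≈ ∣ x ∣ℝ ⊠ ∣ y ∣ℝ
    ∣⊠∣ℝ x y = ≈-pointwise {abs (x * y)} {abs x * abs y} λ n → ℚ.∣p*q∣≡∣p∣*∣q∣ (seq x n) (seq y n)

    ⊠-nonneg : ∀ {x y} → 0ℝ ≤ x → 0ℝ ≤ y → 0ℝ ≤ x ⊠ y
    ⊠-nonneg {x} {y} 0≤x 0≤y = ≤-trans {0ℝ} {abs (x * y)} {x * y} (abs-nonneg (x * y))
      (≈⇒≤ {abs (x * y)} {x * y} (≈-trans {abs (x * y)} {abs x * abs y} {x * y} (∣⊠∣ℝ x y)
        (*-cong {abs x} {x} {abs y} {y} (0≤x⇒abs≈x {x} 0≤x) (0≤x⇒abs≈x {y} 0≤y))))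

    ∣∣ℝ-cong : ∀ {x y} → x ≈ y → ∣ x ∣ℝ ≈ ∣ y ∣ℝ
    ∣∣ℝ-cong {x} {y} = abs-cong {x} {y}

    ∣∣ℝ-nonneg : ∀ x → 0ℝ ≤ ∣ x ∣ℝ
    ∣∣ℝ-nonneg = abs-nonneg

    ∣⊟∣ℝ : ∀ x → ∣ ⊟ x ∣ℝ ≈ ∣ x ∣ℝ
    ∣⊟∣ℝ x = ≈-pointwise {abs (- x)} {abs x} λ n → ℚ.∣-p∣≡∣p∣ (seq x n)

    ∣∣ℝ-square : ∀ x → ∣ x ∣ℝ ⊠ ∣ x ∣ℝ ≈ x ⊠ x
    ∣∣ℝ-square x = ≈-pointwise {abs x * abs x} {x * x} λ n → ∣p∣*∣p∣≡p*p (seq x n)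

    x≤∣x∣ℝ : ∀ x → x ≤ ∣ x ∣ℝ
    x≤∣x∣ℝ = x≤abs

    0≤x⇒∣x∣ℝ≈x : ∀ {x} → 0ℝ ≤ x → ∣ x ∣ℝ ≈ x
    0≤x⇒∣x∣ℝ≈x {x} = 0≤x⇒abs≈x {x}

    ρ²⊠x≈1 : ∀ {x} → 1ℝ ≤ x → (ρ x ⊠ ρ x) ⊠ x ≈ 1ℝ
    ρ²⊠x≈1 {x} = ρ²x≈1 {x}

  ℝ-orderedRing : OrderedRing
  ℝ-orderedRing = record
    { Carrier = ℝ ; _≈_ = _≈_ ; _≤_ = _≤_ ; _+_ = _⊞_ ; _*_ = _⊠_ ; -_ = ⊟_ ; ∣_∣ = ∣_∣ℝ ; ρ = ρ ; ι = fromℚ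
    ; isCommutativeRing = ℝ-isCommutativeRing
    ; ι-+         = fromℚ-⊞
    ; ι-*         = fromℚ-⊠
    ; ι-neg       = fromℚ-⊟
    ; ≤-reflexive = λ {x y} → ≈⇒≤ {x} {y}
    ; ≤-trans     = λ {x y z} → ≤-trans {x} {y} {z}
    ; ≤-antisym   = λ {x y} → ≤-antisym {x} {y}
    ; ≤-cases     = λ {a b} → ≤-cases {a} {b}
    ; ≤-stable    = λ ¬¬p q → ¬¬p λ p → p q
    ; x≤y⇒0≤y-x   = λ {x y} → x≤y⇒0≤y⊟x {x} {y}
    ; 0≤y-x⇒x≤y   = λ {x y} → 0≤y⊟x⇒x≤y {x} {y}
    ; +-nonneg    = λ {x y} → ⊞-nonneg {x} {y}
    ; *-nonneg    = λ {x y} → ⊠-nonneg {x} {y}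
    ; 0≤1#        = ≤-pointwise {0ℝ} {1ℝ} λ _ → 0≤1
    ; abs-cong    = λ {x y} → ∣∣ℝ-cong {x} {y}
    ; abs-nonneg  = ∣∣ℝ-nonneg
    ; abs-neg     = ∣⊟∣ℝ
    ; abs-*       = ∣⊠∣ℝ
    ; abs-square  = ∣∣ℝ-square
    ; x≤∣x∣       = x≤∣x∣ℝ
    ; 0≤x⇒∣x∣≈x   = λ {x} → 0≤x⇒∣x∣ℝ≈x {x}
    ; ρ-cong      = λ {x y} → ρ-cong {x} {y}
    ; ρ-nonneg    = ρ-nonneg
    ; ρ²x≈1       = λ {x} → ρ²⊠x≈1 {x}
    }

  module V = Vectors ℝ-orderedRing

  -- Links sums formed with the opaque addition to the sums in the definition of the spaces.
  seq-∑ : ∀ {n} (p q : Vector ℝ n) k → (∀ i → seq (p i) k ≡ seq (q i) k) → seq (V.∑ p) k ≡ seq (∑ q) k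
  seq-∑ {zero}  p q k h = refl
  seq-∑ {suc n} p q k h = trans (seq-⊞ (p zero) (V.∑ (p ∘ suc)) k)
    (cong₂ ℚ._+_ (h zero) (seq-∑ (p ∘ suc) (q ∘ suc) k (h ∘ suc)))

  V∑≈∑ : ∀ {n} (p : Vector ℝ n) → V.∑ p ≈ ∑ p
  V∑≈∑ p = ≈-pointwise {V.∑ p} {∑ p} λ k → seq-∑ p p k λ _ → refl

  square-norm≈∑ : ∀ {n} (z : Vector ℝ n) → V.square-norm z ≈ ∑ λ i → z i * z i
  square-norm≈∑ z = ≈-pointwise {V.square-norm z} {∑ λ i → z i * z i} λ k →
    seq-∑ (λ i → z i ⊠ z i) (λ i → z i * z i) k λ i → seq-⊠ (z i) (z i) k

  -- Continuity

  -- The triangle inequality applied to x, y, y, the second ball having radius ε - δ > 0.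
  ball-mono : ∀ (X : MetricSpace) {δ ε x y} → δ ℚ.< ε → MetricSpace.Ball X δ x y → MetricSpace.Ball X ε x y
  ball-mono X {δ} {ε} {x} {y} δ<ε b = subst (λ r → Ball r x y)
    (solve 2 (λ d e → d :+ (e :- d) := e) refl δ ε)
    (triangle b (refl-b (subst (ℚ._< ε ℚ.- δ) (ℚ.+-inverseʳ δ) (ℚ.+-monoˡ-< (ℚ.- δ) δ<ε))))
    where
    open MetricSpace X

  common-radius : ∀ {δ η} → 0ℚ ℚ.< δ → 0ℚ ℚ.< η → ∃ λ θ → 0ℚ ℚ.< θ × θ ℚ.< δ × θ ℚ.< η
  common-radius {δ} {η} 0<δ 0<η with ℚ.≤-total δ η
  ... | inj₁ δ≤η = ½ ℚ.* δ , 0<½*p 0<δ , ½p<p 0<δ , ℚ.<-≤-trans (½p<p 0<δ) δ≤η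
  ... | inj₂ η≤δ = ½ ℚ.* η , 0<½*p 0<η , ℚ.<-≤-trans (½p<p 0<η) η≤δ , ½p<p 0<η

  -- A record, so that the function can be inferred from a proof of its continuity.
  record IsContinuous (X : MetricSpace) (f : ∣ X ∣ₛ → ℝ) : Set where
    constructor continuity
    field modulus : Continuous X ℝ-space f

  open IsContinuous

  module _ {X : MetricSpace} where
    open MetricSpace X using (Ball)

    coordinatewise : ∀ {n} {f : ∣ X ∣ₛ → Vector ℝ n} →
      (∀ i → IsContinuous X λ x → f x i) → Continuous X (ℝ-space ^ₛ n) f
    coordinatewise {zero}  cf x ε 0<ε = ε , 0<ε , λ _ _ ()
    coordinatewise {suc n} {f} cf x ε 0<ε =
      let δ , 0<δ , hδ = modulus (cf zero) x ε 0<ε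
          η , 0<η , hη = coordinatewise {n} {λ x → f x ∘ suc} (λ i → cf (suc i)) x ε 0<ε
          θ , 0<θ , θ<δ , θ<η = common-radius 0<δ 0<η
      in θ , 0<θ , λ x′ b → λ where
           zero    → hδ x′ (ball-mono X θ<δ b)
           (suc i) → hη x′ (ball-mono X θ<η b) i

    const-continuous : ∀ c → IsContinuous X λ _ → c
    const-continuous c = continuity λ x ε 0<ε → ε , 0<ε , λ _ _ → MetricSpace.refl-b ℝ-space {ε} {c} 0<ε

    unary : ∀ (φ : ℝ → ℝ) →
      (∀ a ε → 0ℚ ℚ.< ε → ∃ λ δ → 0ℚ ℚ.< δ × (∀ a′ → Close δ a a′ → Close ε (φ a) (φ a′))) →
      ∀ {f} → IsContinuous X f → IsContinuous X λ x → φ (f x)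
    unary φ φ-close {f} cf = continuity λ x ε 0<ε →
      let δ , 0<δ , h = φ-close (f x) (½ ℚ.* ε) (0<½*p 0<ε)
          η , 0<η , k = modulus cf x δ 0<δ
      in η , 0<η , λ x′ b → close⇒ball (φ (f x)) (φ (f x′)) 0<ε
           (h (f x′) (ball⇒close (f x) (f x′) (k x′ b)))

    binary : ∀ (φ : ℝ → ℝ → ℝ) →
      (∀ a b ε → 0ℚ ℚ.< ε → ∃ λ δ → 0ℚ ℚ.< δ ×
         (∀ a′ b′ → Close δ a a′ → Close δ b b′ → Close ε (φ a b) (φ a′ b′))) →
      ∀ {f g} → IsContinuous X f → IsContinuous X g → IsContinuous X λ x → φ (f x) (g x)
    binary φ φ-close {f} {g} cf cg = continuity λ x ε 0<ε →
      let δ , 0<δ , h = φ-close (f x) (g x) (½ ℚ.* ε) (0<½*p 0<ε)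
          η , 0<η , k = modulus cf x δ 0<δ
          θ , 0<θ , l = modulus cg x δ 0<δ
          ζ , 0<ζ , ζ<η , ζ<θ = common-radius 0<η 0<θ
      in ζ , 0<ζ , λ x′ b → close⇒ball (φ (f x) (g x)) (φ (f x′) (g x′)) 0<ε
           (h (f x′) (g x′) (ball⇒close (f x) (f x′) (k x′ (ball-mono X ζ<η b)))
                            (ball⇒close (g x) (g x′) (l x′ (ball-mono X ζ<θ b))))

    abstract

      ⊞-continuous : ∀ {f g} → IsContinuous X f → IsContinuous X g → IsContinuous X λ x → f x ⊞ g x
      ⊞-continuous = binary _+_ λ a b ε 0<ε → ½ ℚ.* ε , 0<½*p 0<ε , +-close {ε} a b

      ⊠-continuous : ∀ {f g} → IsContinuous X f → IsContinuous X g → IsContinuous X λ x → f x ⊠ g x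
      ⊠-continuous = binary _*_ *-close

      ⊟-continuous : ∀ {f} → IsContinuous X f → IsContinuous X λ x → ⊟ f x
      ⊟-continuous = unary -_ λ a ε 0<ε → ε , 0<ε , neg-close {ε} a

      ∣∣ℝ-continuous : ∀ {f} → IsContinuous X f → IsContinuous X λ x → ∣ f x ∣ℝ
      ∣∣ℝ-continuous = unary abs λ a ε 0<ε → ε , 0<ε , abs-close {ε} a

    ρ-continuous : ∀ {f} → IsContinuous X f → IsContinuous X λ x → ρ (f x)
    ρ-continuous = unary ρ λ a ε 0<ε → ½ ℚ.* ε , 0<½*p 0<ε , λ a′ → ρ-close {ε} a a′ 0<ε

    ∑-continuous : ∀ {n} {f : ∣ X ∣ₛ → Vector ℝ n} →
      (∀ i → IsContinuous X λ x → f x i) → IsContinuous X λ x → V.∑ (f x)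
    ∑-continuous {zero}  cf = const-continuous 0ℝ
    ∑-continuous {suc n} cf = ⊞-continuous (cf zero) (∑-continuous λ i → cf (suc i))

    ⊕-continuous : ∀ {n} {u v : ∣ X ∣ₛ → Vector ℝ n} →
      (∀ i → IsContinuous X λ a → u a i) → (∀ i → IsContinuous X λ a → v a i) →
      ∀ i → IsContinuous X λ a → (u a V.⊕ v a) i
    ⊕-continuous {n} cu cv i with splitAt n i
    ... | inj₁ j = cu j
    ... | inj₂ j = cv j

    normalise-continuous : ∀ {n} {p : ∣ X ∣ₛ → Vector ℝ n} → (∀ v → IsContinuous X λ a → p a v) →
      ∀ v → IsContinuous X λ a → V.normalise (p a) v
    normalise-continuous cp v =
      ⊠-continuous (cp v) (⊠-continuous (ρ-continuous (∑-continuous cp)) (ρ-continuous (∑-continuous cp)))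

    pos-continuous : ∀ {f} → IsContinuous X f → IsContinuous X λ a → V.pos (f a)
    pos-continuous cf = ⊞-continuous (∣∣ℝ-continuous cf) cf

    neg-part-continuous : ∀ {f} → IsContinuous X f → IsContinuous X λ a → V.neg (f a)
    neg-part-continuous cf = ⊞-continuous (∣∣ℝ-continuous cf) (⊟-continuous cf)

    signed-continuous : ∀ {n} {z : ∣ X ∣ₛ → Vector ℝ n} → (∀ i → IsContinuous X λ a → z a i) →
      ∀ v → IsContinuous X λ a → V.signed (z a) v
    signed-continuous cz = ⊕-continuous (λ i → pos-continuous (cz i)) (λ i → neg-part-continuous (cz i))

    module _ {n} {x y : ∣ X ∣ₛ → Vector ℝ n}
      (cx : ∀ i → IsContinuous X λ a → x a i) (cy : ∀ i → IsContinuous X λ a → y a i) where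

      twice-min-continuous : ∀ j → IsContinuous X λ a → V.twice-min (x a) (y a) j
      twice-min-continuous j = ⊞-continuous (⊞-continuous (cx j) (cy j))
        (⊟-continuous (∣∣ℝ-continuous (⊞-continuous (cx j) (⊟-continuous (cy j)))))

      path-continuous : ∀ {t} → IsContinuous X t → ∀ i → IsContinuous X λ a → V.path (x a) (y a) (t a) i
      path-continuous ct i = ⊞-continuous (cx i) (⊟-continuous (⊠-continuous
        (⊞-continuous (const-continuous 1ℝ) (⊟-continuous ct))
        (⊞-continuous (cy i) (∑-continuous twice-min-continuous))))

      deformed-continuous : ∀ {t} → IsContinuous X t → ∀ v → IsContinuous X λ a → V.deformed (x a) (y a) (t a) v
      deformed-continuous ct = ⊕-continuous
        (λ i → ⊠-continuous (const-continuous (V.κ n)) (pos-continuous (path-continuous ct i)))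
        (λ i → ⊠-continuous (const-continuous (V.κ n)) (⊞-continuous
                 (neg-part-continuous (path-continuous ct i)) (⊠-continuous ct (⊞-continuous (cy i) (cy i)))))

      toSphere-continuous : ∀ i → IsContinuous X λ a → V.toSphere (x a) (y a) i
      toSphere-continuous i = ⊠-continuous (scaled-path-continuous i)
        (ρ-continuous (∑-continuous λ j → ⊠-continuous (scaled-path-continuous j) (scaled-path-continuous j)))
        where
        scaled-path-continuous : ∀ i → IsContinuous X λ a → V.scaled-path (x a) (y a) i
        scaled-path-continuous i =
          ⊠-continuous (const-continuous (V.ν n V.* V.κ n)) (path-continuous (const-continuous 0ℝ) i)

-- The homotopy equivalence.

module Equivalences where

  open import Data.Fin.Subset using (⁅_⁆; _∈_; _∪_)
  open import Data.Fin.Subset.Properties using (x∈⁅x⁆; x∈⁅y⁆⇒x≡y; x∈p∪q⁺; x∈p∪q⁻)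
  open import Relation.Binary.PropositionalEquality using (sym; subst)
  open import Defs
  open Reals
  open WhiskeredCycles

  ≈⇒ball : ∀ {ε} x y → 0ℚ ℚ.< ε → x ≈ y → ℝ-Ball ε x y
  ≈⇒ball {ε} x y 0<ε x≈y = close⇒ball x y 0<ε (≈⇒close {x} {y} x≈y (0<½*p 0<ε))

  square-norm⇒sphere : ∀ {n} (z : Vector ℝ n) → V.square-norm z ≈ 1ℝ → ∑ (λ i → z i * z i) ≈ 1ℝ
  square-norm⇒sphere z = ≈-trans {∑ λ i → z i * z i} {V.square-norm z} {1ℝ}
    (≈-sym {V.square-norm z} {∑ λ i → z i * z i} (square-norm≈∑ z))

  sphere⇒square-norm : ∀ {n} (z : Vector ℝ n) → ∑ (λ i → z i * z i) ≈ 1ℝ → V.square-norm z ≈ 1ℝ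
  sphere⇒square-norm z = ≈-trans {V.square-norm z} {∑ λ i → z i * z i} {1ℝ} (square-norm≈∑ z)

  -- Indexed by the number of coordinates; `UnitSphere (suc m)` is definitionally `Sphere m`.
  UnitSphere : ℕ → MetricSpace
  UnitSphere n = Subspace (ℝ-space ^ₛ n) λ z → ∑ (λ i → z i * z i) ≈ 1ℝ

  module Equivalence (n : ℕ) (3≤n : 3 ℕ.≤ n) (i₀ : Fin n) where

    open WhiskeredCycle n 3≤n

    |K| : MetricSpace
    |K| = Realisation (M₂ G)

    -- The face condition tested on the minimal non-faces only, in a negative form that classical
    -- case distinctions can establish.
    Supported : Vector ℝ (n ℕ.+ n) → Set
    Supported p = ∀ j → ¬ (p (edge j) ≤ 0ℝ) → ¬ (p (edge (succ j)) ≤ 0ℝ) → p (whisker (succ j)) ≤ 0ℝ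

    supported⇒face : ∀ p → Supported p →
      ∀ σ → (∀ {v} → v ∈ σ → 0ℝ < p v) → Graph.Is2Matching G σ
    supported⇒face p sup σ pos = ¬triple⇒2-matching λ (j , e∈ , f∈ , w∈) →
      sup j (λ e≤0 → e≤0 (pos e∈)) (λ f≤0 → f≤0 (pos f∈)) (pos w∈)

    -- Unfolding `≤`, the hypotheses are double negations of positivity and the goal is a negation,
    -- so the double negations can be stripped. Positivity on the three-element set would then make
    -- it a 2-matching.
    face⇒supported : (a : ∣ |K| ∣ₛ) → Supported (proj₁ a)
    face⇒supported (p , _ , _ , face) j e≰0 f≰0 0<w = e≰0 λ 0<e → f≰0 λ 0<f →
      triple⇒¬2-matching
        (j , x∈p∪q⁺ (inj₁ (x∈⁅x⁆ (edge j))) , x∈p∪q⁺ (inj₂ (x∈p∪q⁺ (inj₁ (x∈⁅x⁆ (edge (succ j))))))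
           , x∈p∪q⁺ (inj₂ (x∈p∪q⁺ (inj₂ (x∈⁅x⁆ (whisker (succ j)))))))
        (face (⁅ edge j ⁆ ∪ (⁅ edge (succ j) ⁆ ∪ ⁅ whisker (succ j) ⁆)) (λ v∈ →
          [ (λ v∈e → at v∈e 0<e)
          , (λ v∈fw → [ (λ v∈f → at v∈f 0<f) , (λ v∈w → at v∈w 0<w) ]′ (x∈p∪q⁻ _ _ v∈fw)) ]′ (x∈p∪q⁻ _ _ v∈)))
      where
      at : ∀ {u v} → v ∈ ⁅ u ⁆ → 0ℝ < p u → 0ℝ < p v
      at {u} v∈ = subst (λ k → 0ℝ < p k) (sym (x∈⁅y⁆⇒x≡y u v∈))

    xs ys : ∣ |K| ∣ₛ → Vector ℝ n
    xs a = V.left n (proj₁ a)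
    ys a = V.right n (proj₁ a)

    admissible : ∀ a → V.Admissible (xs a) (ys a)
    admissible a@(p , p-nonneg , ∑p≈1 , _) = record
      { x-nonneg = λ i → p-nonneg (edge i)
      ; y-nonneg = λ i → p-nonneg (whisker i)
      ; total    = V.∑-left+∑-right≈1 n p (≈-trans {V.∑ p} {∑ p} {1ℝ} (V∑≈∑ p) ∑p≈1)
      -- The whisker at i belongs to the triple indexed by `prev i`.
      ; x>0⇒y≤0  = λ x>0 i → subst (λ k → p (whisker k) ≤ 0ℝ) (succ-prev i)
          (face⇒supported a (prev i) (x>0 (prev i)) (x>0 (succ (prev i))))
      }

    normalised : (p : Vector ℝ (n ℕ.+ n)) → (∀ v → 0ℝ ≤ p v) → 1ℝ ≤ V.∑ p →
      Supported (V.normalise p) → ∣ |K| ∣ₛ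
    normalised p 0≤p 1≤∑p sup =
      V.normalise p , V.normalise-nonneg p 0≤p , 
      ≈-trans {∑ (V.normalise p)} {V.∑ (V.normalise p)} {1ℝ}
        (≈-sym {V.∑ (V.normalise p)} {∑ (V.normalise p)} (V∑≈∑ (V.normalise p))) (V.∑-normalise p 1≤∑p) ,
      supported⇒face (V.normalise p) sup

    to-sphere : ∣ |K| ∣ₛ → ∣ UnitSphere n ∣ₛ
    to-sphere a = V.toSphere (xs a) (ys a) ,
      square-norm⇒sphere (V.toSphere (xs a) (ys a)) (V.toSphere-unit (admissible a) i₀)

    from-sphere : ∣ UnitSphere n ∣ₛ → ∣ |K| ∣ₛ
    from-sphere (z , z²≈1) = normalised (V.signed z) (V.signed-nonneg z)
      (V.1≤∑-signed z (sphere⇒square-norm z z²≈1))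
      λ j _ f≰0 → V.signed-support z (succ j) f≰0

    deform : ∣ |K| ×ₛ I ∣ₛ → ∣ |K| ∣ₛ
    deform (a , t , 0≤t , t≤1) = normalised (V.deformed (xs a) (ys a) t)
      (V.deformed-nonneg (admissible a) {t} 0≤t) (V.1≤∑-deformed (admissible a) {t} 0≤t t≤1)
      λ j e≰0 f≰0 → V.deformed-right-support (admissible a) t (succ j) f≰0
        (face⇒supported a j (V.deformed-left-support (admissible a) {t} t≤1 j e≰0)
                            (V.deformed-left-support (admissible a) {t} t≤1 (succ j) f≰0))

    coordinate : ∀ v → IsContinuous |K| λ a → proj₁ a v
    coordinate v = continuity λ a ε 0<ε → ε , 0<ε , λ a′ b → b v

    to-sphere-continuous : Continuous |K| (UnitSphere n) to-sphere
    to-sphere-continuous = coordinatewise {X = |K|} {f = λ a → V.toSphere (xs a) (ys a)}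
      (toSphere-continuous (λ i → coordinate (edge i)) (λ i → coordinate (whisker i)))

    from-sphere-continuous : Continuous (UnitSphere n) |K| from-sphere
    from-sphere-continuous = coordinatewise {X = UnitSphere n} {f = λ z → V.normalise (V.signed (proj₁ z))}
      (normalise-continuous (signed-continuous λ i → continuity λ z ε 0<ε → ε , 0<ε , λ z′ b → b i))

    deform-continuous : Continuous (|K| ×ₛ I) |K| deform
    deform-continuous = coordinatewise
      {X = |K| ×ₛ I} {f = λ (a , t) → V.normalise (V.deformed (xs a) (ys a) (proj₁ t))}
      (normalise-continuous (deformed-continuous {x = λ (a , t) → xs a} {λ (a , t) → ys a}
        (λ i → continuity λ _ ε 0<ε → ε , 0<ε , λ _ b → proj₁ b (edge i))
        (λ i → continuity λ _ ε 0<ε → ε , 0<ε , λ _ b → proj₁ b (whisker i))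
        {λ (a , t) → proj₁ t} (continuity λ _ ε 0<ε → ε , 0<ε , λ _ b → proj₂ b)))

    deform-start : ∀ a → MetricSpace._≋_ |K| (deform (a , 0ᴵ)) (from-sphere (to-sphere a))
    deform-start a ε 0<ε v = ≈⇒ball {ε}
      (V.normalise (V.deformed (xs a) (ys a) 0ℝ) v) (V.normalise (V.signed (V.toSphere (xs a) (ys a))) v) 0<ε
      (V.deformed-start (admissible a) i₀ v)

    deform-end : ∀ a → MetricSpace._≋_ |K| (deform (a , 1ᴵ)) a
    deform-end a ε 0<ε v = ≈⇒ball {ε} (V.normalise (V.deformed (xs a) (ys a) 1ℝ) v) (proj₁ a v) 0<ε
      (V.deformed-end (proj₁ a) (admissible a) v)

    to∘from≋id : ∀ z → MetricSpace._≋_ (UnitSphere n) z (to-sphere (from-sphere z))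
    to∘from≋id z ε 0<ε i = ≈⇒ball {ε} (proj₁ z i) (proj₁ (to-sphere (from-sphere z)) i) 0<ε
      (≈-sym {proj₁ (to-sphere (from-sphere z)) i} {proj₁ z i}
        (V.toSphere∘signed (proj₁ z) (sphere⇒square-norm (proj₁ z) (proj₂ z)) i₀
          (admissible (from-sphere z)) i))

    equivalence : |K| ≃ UnitSphere n
    equivalence = record
      { to      = record { fun = to-sphere ; continuous = to-sphere-continuous }
      ; from    = record { fun = from-sphere ; continuous = from-sphere-continuous }
      ; from∘to = record
        { map   = record { fun = deform ; continuous = deform-continuous }
        ; start = deform-start
        ; end   = deform-end
        }
      ; to∘from = record
        { map   = record { fun = proj₁ ; continuous = λ _ ε 0<ε → ε , 0<ε , λ _ → proj₁ }
        ; start = to∘from≋id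
        ; end   = λ z ε 0<ε → MetricSpace.refl-b (UnitSphere n) {ε} {z} 0<ε
        }
      }


open import Data.Nat.Base using (_≤_; _∸_)
open import Data.Nat.Divisibility.Core using (_∣_)
open import Defs using (Realisation; M₂; whiskered; cycle; _≃_; Sphere)

mainTheorem7 : (n : ℕ) (3≤n : 3 ≤ n) → ¬ (2 ∣ n) →
    Realisation (M₂ (whiskered (cycle n 3≤n))) ≃ Sphere (n ∸ 1)
-- Matching on `suc m` lets `n ∸ 1` compute, and `zero` is the index witnessing 1 ≤ n.
mainTheorem7 (suc m) 3≤n _ = Equivalences.Equivalence.equivalence (suc m) 3≤n zero
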